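{- Let $v,w\in S_n$. If $S\subseteq D(v)$ is not a face of the pipe complex $\Delta_{v,w}$, then the monomial $\prod_{(i,j)\in S}z_{ij}\in\mathbb{C}[\mathbf{z}^{(v)}]$ is divisible by the $\prec$-leading term of one of the essential minors of $I_{v,w}$.
   Context: $w_0$ is the longest element of $S_n$, $s_k=(k\leftrightarrow k+1)$, $\ell$ is length. Positions $(i,j)$: row $i$ from the bottom, column $j$ from the left. For $v\in S_n$, $Z^{(v)}$ has entry $1$ at $(n-v(j)+1,j)$, entries $0$ at $(n-v(j)+1,a)$, $a>j$, and at $(b,j)$, $b>n-v(j)+1$, and distinct indeterminates $z_{ij}$ elsewhere, forming $\mathbf{z}^{(v)}$; their positions form the Rothe diagram $D(v)=\{(i,j): i<n-v(j)+1,\ j<v^{ -1}(n-i+1)\}$. With $r^w_{ij}=\#\{k\le j: w(k)\ge n-i+1\}$ and $Z^{(v)}_{ij}$ the submatrix of bottom $i$ rows and leftmost $j$ columns, the essential minors of $I_{v,w}$ are the minors of size $1+r^w_{ij}$ of $Z^{(v)}_{ij}$ for $(i,j)$ in the essential set $\mathcal{E}(w)=\{(i,j)\in D(w):(i+1,j)\notin D(w),(i,j+1)\notin D(w)\}$. The term order $\prec$ is lexicographic with $z_{ij}\prec z_{kl}$ iff $j<l$, or $j=l$ and $i>k$. Canonical labeling: the $t$ boxes of row $i$ of $D(v)$ get labels $i,\dots,i+t-1$ left to right; reading order rows top to bottom, left to right; the Demazure product of labels $a_1,\dots,a_m$ is $\delta(\emptyset)=\mathrm{id}$, $\delta(a_1..a_m)=\delta(a_1..a_{m-1})s_{a_m}$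 if this increases length, else $\delta(a_1..a_{m-1})$. A subset $P\subseteq D(v)$ is a pipe dream for $u$ if the Demazure product of its labels in reading order is $u$. The pipe complex $\Delta_{v,w}$ is the simplicial complex on vertex set $D(v)$ whose faces are the $F\subseteq D(v)$ such that $D(v)\setminus F$ contains a pipe dream for $w_0w$. -}

module Defs where

open import Data.Bool using (Bool; true; false; if_then_else_; _∧_)
open import Data.Nat using (ℕ; zero; suc; _+_; _∸_; _≤_; _<_; _≡ᵇ_; _<ᵇ_; _≤ᵇ_)
open import Data.Nat.Properties using (_≟_)
open import Data.Integer as ℤ using (ℤ)
open import Data.Fin using (Fin; toℕ; opposite; punchIn)
  renaming (zero to fzero; suc to fsuc)
open import Data.Fin.Properties using (all?)
open import Data.Fin.Permutation using (Permutation′; _⟨$⟩ʳ_; _⟨$⟩ˡ_)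
open import Data.List using (List; []; _∷_; map; concatMap; length; filterᵇ; allFin; reverse; foldl; foldr)
open import Data.Nat.ListAction using (sum)
open import Data.Product using (_×_; _,_; Σ; ∃)
open import Relation.Binary.PropositionalEquality using (_≡_)
open import Relation.Nullary using (¬_; Dec; does)
open import Data.Sum using (_⊎_)

-- Conventions.  A position is a pair (r , c) : Fin n × Fin n, where the
-- paper's (1-indexed) row-from-the-bottom is  i = pos r  and column is
-- j = pos c.  A permutation v ∈ S_n is a  Permutation′ n ; its value
-- at j (1-indexed) is  val v c , and v⁻¹ at a 1-indexed value is given
-- by  inv v .  The Fin whose 1-indexed value is  n - i + 1  (i = pos r)
-- is  opposite r .

pos : ∀ {n} → Fin n → ℕ
pos x = suc (toℕ x)

val : ∀ {n} → Permutation′ n → Fin n → ℕ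
val v c = pos (v ⟨$⟩ʳ c)

inv : ∀ {n} → Permutation′ n → Fin n → ℕ
inv v k = pos (v ⟨$⟩ˡ k)

inD : ∀ {n} → Permutation′ n → Fin n → Fin n → Bool
inD {n} v r c = (pos r <ᵇ (n + 1 ∸ val v c)) ∧ (pos c <ᵇ inv v (opposite r))

InD : ∀ {n} → Permutation′ n → Fin n → Fin n → Set
InD v r c = inD v r c ≡ true

-- Polynomials in the indeterminates z_{ij} with integer coefficients
-- (all entries of Z^{(v)} are 0, 1 or an indeterminate, so all minors
-- have integer coefficients; ℤ[z] ⊆ ℂ[z]).

Monomial : ℕ → Set
Monomial n = Fin n → Fin n → ℕ

Poly : ℕ → Set
Poly n = List (ℤ × Monomial n)

_≟ₘ_ : ∀ {n} (m m' : Monomial n) → Dec (∀ r c → m r c ≡ m' r c)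
m ≟ₘ m' = all? (λ r → all? (λ c → m r c ≟ m' r c))

coeff : ∀ {n} → Poly n → Monomial n → ℤ
coeff [] m = ℤ.0ℤ
coeff ((a , m') ∷ p) m = if does (m' ≟ₘ m) then a ℤ.+ coeff p m else coeff p m

unitM : ∀ {n} → Monomial n
unitM _ _ = 0

varM : ∀ {n} → Fin n → Fin n → Monomial n
varM r c r' c' = if does (r Data.Fin.≟ r') ∧ does (c Data.Fin.≟ c') then 1 else 0

0P 1P : ∀ {n} → Poly n
0P = []
1P = (ℤ.1ℤ , unitM) ∷ []

varP : ∀ {n} → Fin n → Fin n → Poly n
varP r c = (ℤ.1ℤ , varM r c) ∷ []

_+P_ : ∀ {n} → Poly n → Poly n → Poly n
p +P q = foldr _∷_ q p

_*P_ : ∀ {n} → Poly n → Poly n → Poly n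
p *P q = concatMap (λ { (a , m) → map (λ { (b , m') → (a ℤ.* b , λ r c → m r c + m' r c) }) q }) p

negP : ∀ {n} → Poly n → Poly n
negP = map (λ { (a , m) → (ℤ.- a , m) })

sumP : ∀ {n} → List (Poly n) → Poly n
sumP = foldr _+P_ 0P

evenᵇ : ℕ → Bool
evenᵇ zero = true
evenᵇ (suc k) = if evenᵇ k then false else true

det : ∀ {n} k → (Fin k → Fin k → Poly n) → Poly n
det zero M = 1P
det (suc k) M =
  sumP (map (λ c → sgn c (M fzero c *P det k (λ a b → M (fsuc a) (punchIn c b))))
            (allFin (suc k)))
  where
  sgn : ∀ {n} → Fin (suc k) → Poly n → Poly n
  sgn c p = if evenᵇ (toℕ c) then p else negP p

-- The matrix Z^{(v)}:  1 at (n - v(j) + 1, j);  0 at (n - v(j) + 1, a)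
-- for a > j and at (b, j) for b > n - v(j) + 1;  z_{ij} elsewhere.
-- Row i = pos r has its 1 in column v⁻¹(n - i + 1) = inv v (opposite r).

Zentry : ∀ {n} → Permutation′ n → Fin n → Fin n → Poly n
Zentry {n} v r c =
  if pos r ≡ᵇ (n + 1 ∸ val v c) then 1P
  else if (inv v (opposite r) <ᵇ pos c) then 0P
  else if ((n + 1 ∸ val v c) <ᵇ pos r) then 0P
  else varP r c

count : ∀ {n} → (Fin n → Bool) → ℕ
count {n} f = length (filterᵇ f (allFin n))

rank : ∀ {n} → Permutation′ n → Fin n → Fin n → ℕ
rank {n} w r c = count (λ k → (pos k ≤ᵇ pos c) ∧ ((n + 1 ∸ pos r) ≤ᵇ val w k))

-- essential set:  (i,j) ∈ D(w), (i+1,j) ∉ D(w), (i,j+1) ∉ D(w)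
-- (a position outside the n×n grid is not in D(w))
Essential : ∀ {n} → Permutation′ n → Fin n → Fin n → Set
Essential w r c =
  InD w r c
  × (∀ r' → pos r' ≡ suc (pos r) → ¬ InD w r' c)
  × (∀ c' → pos c' ≡ suc (pos c) → ¬ InD w r c')

StrictlyIncreasing : ∀ {k n} → (Fin k → Fin n) → Set
StrictlyIncreasing f = ∀ a b → toℕ a < toℕ b → toℕ (f a) < toℕ (f b)

record EssentialMinor {n} (v w : Permutation′ n) : Set where
  field
    r c      : Fin n
    ess      : Essential w r c
    rows     : Fin (suc (rank w r c)) → Fin n
    cols     : Fin (suc (rank w r c)) → Fin n
    rows-inc : StrictlyIncreasing rows
    cols-inc : StrictlyIncreasing cols
    rows-bot : ∀ a → pos (rows a) ≤ pos r
    cols-lft : ∀ a → pos (cols a) ≤ pos c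

minorPoly : ∀ {n} {v w : Permutation′ n} → EssentialMinor v w → Poly n
minorPoly {v = v} M = det _ (λ a b → Zentry v (rows a) (cols b))
  where open EssentialMinor M

_≺ᵥ_ : ∀ {n} → (Fin n × Fin n) → (Fin n × Fin n) → Set
(i , j) ≺ᵥ (k , l) = (toℕ j < toℕ l) ⊎ (j ≡ l × toℕ k < toℕ i)

_≺ₘ_ : ∀ {n} → Monomial n → Monomial n → Set
_≺ₘ_ {n} m m' = Σ (Fin n × Fin n) λ { (i , j) →
  (m i j < m' i j) × (∀ k l → (i , j) ≺ᵥ (k , l) → m k l ≡ m' k l) }

IsLeadingMonomial : ∀ {n} → Poly n → Monomial n → Set
IsLeadingMonomial p m =
  ¬ (coeff p m ≡ ℤ.0ℤ) × (∀ m' → ¬ (coeff p m' ≡ ℤ.0ℤ) → ¬ (m ≺ₘ m'))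

_∣ₘ_ : ∀ {n} → Monomial n → Monomial n → Set
m ∣ₘ m' = ∀ r c → m r c ≤ m' r c

Subset² : ℕ → Set
Subset² n = Fin n → Fin n → Bool

monoOf : ∀ {n} → Subset² n → Monomial n
monoOf S r c = if S r c then 1 else 0

_⊆D_ : ∀ {n} → Subset² n → Permutation′ n → Set
S ⊆D v = ∀ r c → S r c ≡ true → InD v r c

-- Demazure products.  Permutations here are functions ℕ → ℕ acting on
-- 1..n (1-indexed values); s_a swaps a and a+1.

sℕ : ℕ → ℕ → ℕ
sℕ a k = if k ≡ᵇ a then suc a else if k ≡ᵇ suc a then a else k


lengthℕ : ℕ → (ℕ → ℕ) → ℕ
lengthℕ n δ = sum (map (λ p → count {n} (λ q → (toℕ p <ᵇ toℕ q) ∧ (δ (pos q) <ᵇ δ (pos p)))) (allFin n))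

demazure : ℕ → List ℕ → (ℕ → ℕ)
demazure n = foldl step (λ k → k)
  where
  step : (ℕ → ℕ) → ℕ → (ℕ → ℕ)
  step δ a = if lengthℕ n δ <ᵇ lengthℕ n (λ k → δ (sℕ a k)) then (λ k → δ (sℕ a k)) else δ

label : ∀ {n} → Permutation′ n → Fin n → Fin n → ℕ
label v r c = pos r + count (λ c' → (toℕ c' <ᵇ toℕ c) ∧ inD v r c')

-- labels of P in reading order: rows top to bottom, left to right
readingWord : ∀ {n} → Permutation′ n → Subset² n → List ℕ
readingWord {n} v P =
  concatMap (λ r → map (label v r) (filterᵇ (P r) (allFin n))) (reverse (allFin n))

-- P is a pipe dream for w₀w :  δ(labels of P) = w₀w, where
-- (w₀w)(k) = n + 1 - w(k)
IsPipeDreamFor-w₀w : ∀ {n} → Permutation′ n → Permutation′ n → Subset² n → Set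
IsPipeDreamFor-w₀w {n} v w P =
  ∀ k → demazure n (readingWord v P) (pos k) ≡ n + 1 ∸ val w k

IsFace : ∀ {n} → Permutation′ n → Permutation′ n → Subset² n → Set
IsFace {n} v w F =
  (F ⊆D v) ×
  Σ (Subset² n) λ P →
    (∀ r c → P r c ≡ true → InD v r c × F r c ≡ false)
    × IsPipeDreamFor-w₀w v w P

{-# OPTIONS --safe #-}

-- Let u be the Demazure product of the labels of D(v) \ S, and write R u i j for #{m ≤ j : u(m) ≤ i}.
-- By the subword property S is a face iff R u ≤ R (w₀w) everywhere.  A violation can be moved to the left
-- or down into D(w), and then up or to the right inside D(w) until it is essential; so it suffices to find,
-- whenever r ≤ R u i j, an r × r minor of the bottom i rows and left j columns of Z^(v) whose leading term
-- only involves variables in S.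
--
-- The products in the expansion of a minor are the matchings of its rows to its columns supported on nonzero
-- entries; distinct ones never cancel, so the leading term is the lexicographically maximal matching.  The
-- matching is built by induction on D(v): the last letter k of the reading word is the rightmost box (p , k)
-- of the lowest nonempty row p, removing it passes from v to v s_k, and Z^(v) arises from Z^(v s_k)
-- by exchanging columns k and k + 1 and adding the variable at (p , k).  Exchanging the two columns carries
-- maximal matchings to maximal matchings, up to removing or adding one edge; this matches the recursion
-- for R u, whose only change under the letter k is in column k, where r ≤ R u i k forces
-- r ≤ R u' i (k - 1) or r + 1 ≤ R u' i (k + 1) for the previous product u'.
module Submission where

open import Defs
open import Data.Bool using (Bool; true; false; if_then_else_; _∧_; not)
open import Data.Bool.Properties using (T-≡; T?; ∧-zeroʳ)
open import Data.Empty using (⊥; ⊥-elim)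
open import Data.Fin using (Fin; toℕ; fromℕ<; opposite; punchIn) renaming (zero to fzero; suc to fsuc)
open import Data.Fin.Permutation using (Permutation′; _⟨$⟩ʳ_; _⟨$⟩ˡ_; inverseʳ; inverseˡ)
open import Data.Fin.Properties using (toℕ-injective; toℕ-fromℕ<; toℕ<n; punchIn-injective; all?; fromℕ<-toℕ; opposite-prop; opposite-involutive)
open import Data.Integer as ℤ using (ℤ)
import Data.Integer.Properties as ℤ
open import Data.List using (List; []; _∷_; _++_; _∷ʳ_; map; concat; concatMap; length; filterᵇ; allFin; reverse; tabulate; cartesianProduct; applyDownFrom)
open import Data.List.Membership.Propositional using (_∈_; _∉_)
open import Data.List.Membership.Propositional.Properties using (∈-map⁺; ∈-map⁻; ∈-∃++; ∈-tabulate⁺; ∈-tabulate⁻; ∈-allFin)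
open import Data.List.Properties using (map-tabulate; foldl-++; filter-++; map-++; ++-identityʳ; ++-assoc; map-∘; map-id; map-cong; length-map; unfold-reverse; reverse-map; concat-++)
open import Data.List.Relation.Binary.Permutation.Propositional using (_↭_; prep; swap; ↭-refl; ↭-sym; ↭-trans; ↭-reflexive; ↭⇒↭ₛ)
open import Data.List.Relation.Binary.Permutation.Propositional.Properties using (∈-resp-↭; All-resp-↭; shift; drop-∷; ↭-length; ↭-reverse) renaming (map⁺ to ↭-map⁺)
import Data.List.Relation.Binary.Permutation.Setoid.Properties as Permutationₛ
open import Data.List.Relation.Unary.All as All using (All; []; _∷_)
import Data.List.Relation.Unary.All.Properties as All
open import Data.List.Relation.Unary.AllPairs as AllPairs using ([]; _∷_)
open import Data.List.Relation.Unary.Any using (here; there)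
open import Data.List.Relation.Unary.Linked.Properties using (Linked⇒AllPairs)
open import Data.List.Relation.Unary.Unique.Propositional using (Unique)
import Data.List.Relation.Unary.Unique.Propositional.Properties as Unique
open import Data.List.Reverse using (Reverse; reverseView; _∶_∶ʳ_) renaming ([] to []ʳ)
open import Data.Nat
open import Data.Nat.Induction using (<-rec)
open import Data.Nat.ListAction using (sum)
open import Data.Nat.Properties
open import Data.List.Membership.DecPropositional _≟_ using (_∈?_)
open import Data.List.Sort ≤-decTotalOrder using (sort; sort-↭; sort-↗)
open import Data.Product using (Σ; ∃; _×_; _,_; proj₁; proj₂)
import Data.Product.Properties as Product
open import Data.Sum using (_⊎_; inj₁; inj₂)
open import Function using (_∘_; id; Equivalence)
open import Relation.Binary.Definitions using (tri<; tri≈; tri>)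
open import Relation.Binary.PropositionalEquality hiding (J)
open import Relation.Nullary using (¬_; Dec; yes; no; does; contradiction)
open import Relation.Nullary.Decidable using (dec-true; dec-false)

-- Larger in Bruhat order means smaller `R`. A nonface is thus a failure of `u` to lie above `w₀w`,
-- and a strict inequality `R (w₀w) i j < R u i j` asks for a minor of size one more than the rank
-- at `(i , j)`, which at an essential position is exactly the size of an essential minor.
--
-- The recursion for `R u` in column `k` reaches into the columns `k - 1` and `k + 1`, so the
-- inductive statement has to cover all rectangles and all sizes, not only the essential ones, and
-- every `S`, because the column exchange moves `S` as well.
--
-- The obstacle is maximality. After the exchange a competing matching may use the new variable at
-- `(p , k)`, which sits on a zero of the old matrix, so that the competitor has no counterpart
-- there. This needs a matching that uses row `p` and the old column `k + 1` but not the old column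
-- `k`. In all other cases the exchange alone suffices; in this one an edge must be traded for a
-- unit entry or given up.

-- Boolean tests and the propositions they decide.

true⇒< : ∀ {m n} → (m <ᵇ n) ≡ true → m < n
true⇒< {m} {n} eq = <ᵇ⇒< m n (Equivalence.from T-≡ eq)

<⇒true : ∀ {m n} → m < n → (m <ᵇ n) ≡ true
<⇒true p = Equivalence.to T-≡ (<⇒<ᵇ p)

≮⇒false : ∀ {m n} → ¬ m < n → (m <ᵇ n) ≡ false
≮⇒false {m} {n} p with m <ᵇ n in eq
... | true = contradiction (true⇒< eq) p
... | false = refl

true⇒≤ : ∀ {m n} → (m ≤ᵇ n) ≡ true → m ≤ n
true⇒≤ {m} {n} eq = ≤ᵇ⇒≤ m n (Equivalence.from T-≡ eq)

≤⇒true : ∀ {m n} → m ≤ n → (m ≤ᵇ n) ≡ true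
≤⇒true p = Equivalence.to T-≡ (≤⇒≤ᵇ p)

≰⇒false : ∀ {m n} → ¬ m ≤ n → (m ≤ᵇ n) ≡ false
≰⇒false {m} {n} p with m ≤ᵇ n in eq
... | true = contradiction (true⇒≤ eq) p
... | false = refl

true⇒≡ : ∀ {m n} → (m ≡ᵇ n) ≡ true → m ≡ n
true⇒≡ {m} {n} eq = ≡ᵇ⇒≡ m n (Equivalence.from T-≡ eq)

≡⇒true : ∀ {m n} → m ≡ n → (m ≡ᵇ n) ≡ true
≡⇒true {m} {n} p = Equivalence.to T-≡ (≡⇒≡ᵇ m n p)

≢⇒false : ∀ {m n} → m ≢ n → (m ≡ᵇ n) ≡ false
≢⇒false {m} {n} p with m ≡ᵇ n in eq
... | true = contradiction (true⇒≡ eq) p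
... | false = refl

∧-true : ∀ {a b} → a ≡ true → b ≡ true → (a ∧ b) ≡ true
∧-true refl refl = refl

∧-true⁻ : ∀ {a b} → (a ∧ b) ≡ true → a ≡ true × b ≡ true
∧-true⁻ {true} {true} _ = refl , refl

true≢false : ∀ {b} → b ≡ true → b ≢ false
true≢false refl ()

Bool-ext : ∀ {a b} → (a ≡ true → b ≡ true) → (b ≡ true → a ≡ true) → a ≡ b
Bool-ext {true}  {true}  _ _ = refl
Bool-ext {true}  {false} f _ = sym (f refl)
Bool-ext {false} {true}  _ g = g refl
Bool-ext {false} {false} _ _ = refl

-- The adjacent transposition sℕ

sℕ-left : ∀ a → sℕ a a ≡ suc a
sℕ-left a rewrite ≡⇒true {a} refl = refl

sℕ-right : ∀ a → sℕ a (suc a) ≡ a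
sℕ-right a rewrite ≢⇒false {suc a} {a} 1+n≢n | ≡⇒true {a} refl = refl

sℕ-other : ∀ {a k} → k ≢ a → k ≢ suc a → sℕ a k ≡ k
sℕ-other p q rewrite ≢⇒false p | ≢⇒false q = refl

data SwapView (a : ℕ) : ℕ → Set where
  left  : SwapView a a
  right : SwapView a (suc a)
  other : ∀ {k} → k ≢ a → k ≢ suc a → SwapView a k

swapView : ∀ a k → SwapView a k
swapView a k with k ≟ a | k ≟ suc a
... | yes refl | _ = left
... | no _ | yes refl = right
... | no p | no q = other p q

sℕ-involutive : ∀ a k → sℕ a (sℕ a k) ≡ k
sℕ-involutive a k with swapView a k
... | left = trans (cong (sℕ a) (sℕ-left a)) (sℕ-right a)
... | right = trans (cong (sℕ a) (sℕ-right a)) (sℕ-left a)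
... | other p q = trans (cong (sℕ a) (sℕ-other p q)) (sℕ-other p q)

sℕ-injective : ∀ a {k l} → sℕ a k ≡ sℕ a l → k ≡ l
sℕ-injective a {k} {l} eq =
  trans (sym (sℕ-involutive a k)) (trans (cong (sℕ a) eq) (sℕ-involutive a l))

sℕ-left⁻ : ∀ {a k} → sℕ a k ≡ suc a → k ≡ a
sℕ-left⁻ {a} eq = sℕ-injective a (trans eq (sym (sℕ-left a)))

sℕ-right⁻ : ∀ {a k} → sℕ a k ≡ a → k ≡ suc a
sℕ-right⁻ {a} eq = sℕ-injective a (trans eq (sym (sℕ-right a)))

sℕ-mono-< : ∀ a {k l} → k < l → (k ≡ a → l ≢ suc a) → sℕ a k < sℕ a l
sℕ-mono-< a {k} {l} k<l ok with swapView a k | swapView a l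
... | left | left = contradiction k<l (<-irrefl refl)
... | left | right = contradiction refl (ok refl)
... | left | other p q rewrite sℕ-left a | sℕ-other p q = ≤∧≢⇒< k<l (q ∘ sym)
... | right | left = contradiction k<l (<⇒≯ ≤-refl)
... | right | right = contradiction k<l (<-irrefl refl)
... | right | other p q rewrite sℕ-right a | sℕ-other p q = <-trans ≤-refl k<l
... | other p q | left rewrite sℕ-left a | sℕ-other p q = m<n⇒m<1+n k<l
... | other p q | right rewrite sℕ-right a | sℕ-other p q = ≤∧≢⇒< (≤-pred k<l) p
... | other p q | other p' q' rewrite sℕ-other p q | sℕ-other p' q' = k<l

-- Sums and counts over 1, …, m

sumTo : (ℕ → ℕ) → ℕ → ℕ
sumTo h zero    = 0
sumTo h (suc m) = sumTo h m + h (suc m)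

indicator : Bool → ℕ
indicator b = if b then 1 else 0

cnt : (ℕ → Bool) → ℕ → ℕ
cnt g = sumTo (indicator ∘ g)

sumTo-mono : ∀ {h h'} m → (∀ k → 1 ≤ k → k ≤ m → h k ≤ h' k) → sumTo h m ≤ sumTo h' m
sumTo-mono zero _ = z≤n
sumTo-mono (suc m) p =
  +-mono-≤ (sumTo-mono m λ k 1≤k k≤m → p k 1≤k (m≤n⇒m≤1+n k≤m)) (p (suc m) (s≤s z≤n) ≤-refl)

sumTo-cong : ∀ {h h'} m → (∀ k → 1 ≤ k → k ≤ m → h k ≡ h' k) → sumTo h m ≡ sumTo h' m
sumTo-cong m p = ≤-antisym (sumTo-mono m λ k a b → ≤-reflexive (p k a b))
                           (sumTo-mono m λ k a b → ≤-reflexive (sym (p k a b)))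

sumTo-mono-< : ∀ {h h'} m → (∀ k → 1 ≤ k → k ≤ m → h k ≤ h' k) →
  ∀ k → 1 ≤ k → k ≤ m → h k < h' k → sumTo h m < sumTo h' m
sumTo-mono-< zero p k 1≤k k≤m q = contradiction (≤-trans 1≤k k≤m) λ ()
sumTo-mono-< (suc m) p k 1≤k k≤m q with k ≟ suc m
... | yes refl = +-mono-≤-< (sumTo-mono m λ l a b → p l a (m≤n⇒m≤1+n b)) q
... | no k≢ = +-mono-<-≤ (sumTo-mono-< m (λ l a b → p l a (m≤n⇒m≤1+n b)) k 1≤k
                            (≤-pred (≤∧≢⇒< k≤m k≢)) q)
                          (p (suc m) (s≤s z≤n) ≤-refl)

sumTo-head : ∀ h m → sumTo h (suc m) ≡ h 1 + sumTo (h ∘ suc) m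
sumTo-head h zero = sym (+-identityʳ (h 1))
sumTo-head h (suc m) =
  trans (cong (_+ h (suc (suc m))) (sumTo-head h m)) (+-assoc (h 1) _ _)

-- A prefix ending anywhere but at `a` contains both of `a` and `a + 1` or neither. Summation starts
-- at 1, whence `1 ≤ a`.
sumTo-swap : ∀ {a} h m → 1 ≤ a → m ≢ a → sumTo (h ∘ sℕ a) m ≡ sumTo h m
sumTo-swap h zero 1≤a m≢a = refl
sumTo-swap {a} h (suc m) 1≤a m≢a with swapView a (suc m)
... | left = contradiction refl m≢a
... | other p q rewrite sℕ-other p q = cong (_+ h (suc m)) (sumTo-swap h m 1≤a (q ∘ cong suc))
sumTo-swap {suc a} h (suc (suc a)) 1≤a m≢a | right
  rewrite sℕ-left (suc a) | sℕ-right (suc a) | sumTo-swap h a 1≤a (1+n≢n ∘ sym) = begin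
    sumTo h a + h (2 + a) + h (1 + a)   ≡⟨ +-assoc (sumTo h a) _ _ ⟩
    sumTo h a + (h (2 + a) + h (1 + a)) ≡⟨ cong (sumTo h a +_) (+-comm (h (2 + a)) _) ⟩
    sumTo h a + (h (1 + a) + h (2 + a)) ≡⟨ +-assoc (sumTo h a) _ _ ⟨
    sumTo h a + h (1 + a) + h (2 + a)   ∎
  where open ≡-Reasoning

indicator-mono : ∀ {b c} → (b ≡ true → c ≡ true) → indicator b ≤ indicator c
indicator-mono {false} _ = z≤n
indicator-mono {true} f rewrite f refl = ≤-refl

indicator-mono-< : ∀ {b c} → b ≢ true → c ≡ true → indicator b < indicator c
indicator-mono-< {false} _ refl = ≤-refl
indicator-mono-< {true} p _ = contradiction refl p

indicator≤1 : ∀ b → indicator b ≤ 1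
indicator≤1 true = ≤-refl
indicator≤1 false = z≤n

cnt-mono : ∀ {g g'} m → (∀ k → 1 ≤ k → k ≤ m → g k ≡ true → g' k ≡ true) → cnt g m ≤ cnt g' m
cnt-mono m p = sumTo-mono m λ k a b → indicator-mono (p k a b)

cnt-mono-< : ∀ {g g'} m → (∀ k → 1 ≤ k → k ≤ m → g k ≡ true → g' k ≡ true) →
  ∀ k → 1 ≤ k → k ≤ m → g k ≢ true → g' k ≡ true → cnt g m < cnt g' m
cnt-mono-< m p k 1≤k k≤m q q' =
  sumTo-mono-< m (λ l a b → indicator-mono (p l a b)) k 1≤k k≤m (indicator-mono-< q q')

cnt-cong : ∀ {g g'} m → (∀ k → 1 ≤ k → k ≤ m → g k ≡ g' k) → cnt g m ≡ cnt g' m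
cnt-cong m p = sumTo-cong m λ k a b → cong indicator (p k a b)

sum-tabulate : ∀ {n} (f : Fin n → ℕ) h → (∀ p → f p ≡ h (pos p)) → sum (tabulate f) ≡ sumTo h n
sum-tabulate {zero} f h eq = refl
sum-tabulate {suc n} f h eq =
  trans (cong₂ _+_ (eq fzero) (sum-tabulate (f ∘ fsuc) (h ∘ suc) (eq ∘ fsuc)))
        (sym (sumTo-head h n))

sum-allFin : ∀ {n} (f : Fin n → ℕ) h → (∀ p → f p ≡ h (pos p)) → sum (map f (allFin n)) ≡ sumTo h n
sum-allFin f h eq = trans (cong sum (map-tabulate id f)) (sum-tabulate f h eq)

length-filterᵇ : ∀ {A : Set} (f : A → Bool) xs → length (filterᵇ f xs) ≡ sum (map (indicator ∘ f) xs)
length-filterᵇ f [] = refl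
length-filterᵇ f (x ∷ xs) with f x
... | true = cong suc (length-filterᵇ f xs)
... | false = length-filterᵇ f xs

count≡cnt : ∀ {n} (f : Fin n → Bool) g → (∀ p → f p ≡ g (pos p)) → count f ≡ cnt g n
count≡cnt {n} f g eq =
  trans (length-filterᵇ f (allFin n)) (sum-allFin (indicator ∘ f) (indicator ∘ g) (cong indicator ∘ eq))

-- Demazure products

Injective : (ℕ → ℕ) → Set
Injective δ = ∀ {k l} → δ k ≡ δ l → k ≡ l

lengthℕ≡ : ∀ n δ →
  lengthℕ n δ ≡ sumTo (λ p → cnt (λ q → (p <ᵇ q) ∧ (δ q <ᵇ δ p)) n) n
lengthℕ≡ n δ = sum-allFin {n} _ (λ p → cnt (λ q → (p <ᵇ q) ∧ (δ q <ᵇ δ p)) n)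
  λ p → count≡cnt {n} _ (λ q → (pos p <ᵇ q) ∧ (δ q <ᵇ δ (pos p))) λ q → refl

-- Reindexing both sums by `sℕ a` turns the inversions of `δ` into inversions of `δ ∘ sℕ a`: the
-- only pair whose order changes is excluded by the ascent. The pair `(a , suc a)` is gained.
length-ascent : ∀ {n a} δ → 1 ≤ a → a < n → δ a < δ (suc a) → lengthℕ n δ < lengthℕ n (δ ∘ sℕ a)
length-ascent {n} {a} δ 1≤a a<n δa< = begin-strict
  lengthℕ n δ            ≡⟨ lengthℕ≡ n δ ⟩
  sumTo J n              ≡⟨ sumTo-swap J n 1≤a (<⇒≢ a<n ∘ sym) ⟨
  sumTo (J ∘ sℕ a) n     ≡⟨ sumTo-cong n (λ p _ _ → sym (sumTo-swap _ n 1≤a (<⇒≢ a<n ∘ sym))) ⟩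
  sumTo J₁ n             <⟨ sumTo-mono-< n
                             (λ p _ _ → cnt-mono n λ q _ _ t → swapped p q t)
                             a 1≤a (<⇒≤ a<n)
                             (cnt-mono-< n (λ q _ _ → swapped a q)
                               (suc a) (s≤s z≤n) a<n notThere isThere) ⟩
  sumTo J₂ n             ≡⟨ lengthℕ≡ n (δ ∘ sℕ a) ⟨
  lengthℕ n (δ ∘ sℕ a)   ∎
  where
  open ≤-Reasoning
  J J₁ J₂ : ℕ → ℕ
  J p = cnt (λ q → (p <ᵇ q) ∧ (δ q <ᵇ δ p)) n
  J₁ p = cnt (λ q → (sℕ a p <ᵇ sℕ a q) ∧ (δ (sℕ a q) <ᵇ δ (sℕ a p))) n
  J₂ p = cnt (λ q → (p <ᵇ q) ∧ (δ (sℕ a q) <ᵇ δ (sℕ a p))) n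
  swapped : ∀ p q → (sℕ a p <ᵇ sℕ a q) ∧ (δ (sℕ a q) <ᵇ δ (sℕ a p)) ≡ true →
    (p <ᵇ q) ∧ (δ (sℕ a q) <ᵇ δ (sℕ a p)) ≡ true
  swapped p q t with t₁ , t₂ ← ∧-true⁻ {sℕ a p <ᵇ sℕ a q} t =
    ∧-true (<⇒true (subst₂ _<_ (sℕ-involutive a p) (sℕ-involutive a q)
      (sℕ-mono-< a (true⇒< {sℕ a p} {sℕ a q} t₁) λ e e' →
        <⇒≯ δa< (subst₂ _<_ (cong δ e') (cong δ e) (true⇒< t₂))))) t₂
  notThere : (sℕ a a <ᵇ sℕ a (suc a)) ∧ (δ (sℕ a (suc a)) <ᵇ δ (sℕ a a)) ≢ true
  notThere t = <⇒≯ {a} ≤-refl (subst₂ _<_ (sℕ-left a) (sℕ-right a) (true⇒< {sℕ a a} {sℕ a (suc a)} (proj₁ (∧-true⁻ t))))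
  isThere : (a <ᵇ suc a) ∧ (δ (sℕ a (suc a)) <ᵇ δ (sℕ a a)) ≡ true
  isThere rewrite sℕ-left a | sℕ-right a = ∧-true (<⇒true {a} ≤-refl) (<⇒true δa<)

lengthℕ-cong : ∀ n {δ δ'} → (∀ k → δ k ≡ δ' k) → lengthℕ n δ ≡ lengthℕ n δ'
lengthℕ-cong n {δ} {δ'} eq = begin
  lengthℕ n δ  ≡⟨ lengthℕ≡ n δ ⟩
  sumTo (λ p → cnt (λ q → (p <ᵇ q) ∧ (δ q <ᵇ δ p)) n) n ≡⟨ sumTo-cong n (λ p _ _ → cnt-cong n λ q _ _ → cong ((p <ᵇ q) ∧_) (cong₂ _<ᵇ_ (eq q) (eq p))) ⟩
  sumTo (λ p → cnt (λ q → (p <ᵇ q) ∧ (δ' q <ᵇ δ' p)) n) n ≡⟨ lengthℕ≡ n δ' ⟨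
  lengthℕ n δ' ∎
  where open ≡-Reasoning

length-descent : ∀ {n a} δ → 1 ≤ a → a < n → δ (suc a) < δ a → lengthℕ n (δ ∘ sℕ a) < lengthℕ n δ
length-descent {n} {a} δ 1≤a a<n δa> =
  subst (lengthℕ n (δ ∘ sℕ a) <_)
    (lengthℕ-cong n λ k → cong δ (sℕ-involutive a k))
    (length-ascent (δ ∘ sℕ a) 1≤a a<n
      (subst₂ _<_ (cong δ (sym (sℕ-left a))) (cong δ (sym (sℕ-right a))) δa>))

demazure-∷ʳ : ∀ n Q a → demazure n (Q ∷ʳ a) ≡
  (if lengthℕ n (demazure n Q) <ᵇ lengthℕ n (demazure n Q ∘ sℕ a)
   then demazure n Q ∘ sℕ a else demazure n Q)
demazure-∷ʳ n Q a = foldl-++ _ id Q (a ∷ [])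

demazure-ascent : ∀ {n a} Q → 1 ≤ a → a < n → demazure n Q a < demazure n Q (suc a) →
  demazure n (Q ∷ʳ a) ≡ demazure n Q ∘ sℕ a
demazure-ascent {n} {a} Q 1≤a a<n lt
  rewrite demazure-∷ʳ n Q a | <⇒true (length-ascent (demazure n Q) 1≤a a<n lt) = refl

demazure-descent : ∀ {n a} Q → 1 ≤ a → a < n → demazure n Q (suc a) < demazure n Q a →
  demazure n (Q ∷ʳ a) ≡ demazure n Q
demazure-descent {n} {a} Q 1≤a a<n lt
  rewrite demazure-∷ʳ n Q a | ≮⇒false (<⇒≯ (length-descent (demazure n Q) 1≤a a<n lt)) = refl

-- For properties that survive whichever way the length test goes, so that no ascent has to be
-- decided.
demazure-preserves : ∀ (Q : (ℕ → ℕ) → Set) n W a →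
  Q (demazure n W) → Q (demazure n W ∘ sℕ a) → Q (demazure n (W ∷ʳ a))
demazure-preserves Q n W a p q rewrite demazure-∷ʳ n W a
  with lengthℕ n (demazure n W) <ᵇ lengthℕ n (demazure n W ∘ sℕ a)
... | true = q
... | false = p

demazure-injective : ∀ n W → Injective (demazure n W)
demazure-injective n W = go (reverseView W)
  where
  go : ∀ {W} → Reverse W → Injective (demazure n W)
  go []ʳ eq = eq
  go (W ∶ r ∶ʳ a) = demazure-preserves Injective n W a (go r) (sℕ-injective a ∘ go r)

-- The rank function `R` and its change under one letter.

R : (ℕ → ℕ) → ℕ → ℕ → ℕ
R u i = cnt (λ m → u m ≤ᵇ i)

R-swap : ∀ u i {a j} → 1 ≤ a → j ≢ a → R (u ∘ sℕ a) i j ≡ R u i j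
R-swap u i {a} {j} 1≤a j≢a = sumTo-swap (λ m → indicator (u m ≤ᵇ i)) j 1≤a j≢a

R-≤-suc : ∀ u i j → R u i (suc j) ≤ suc (R u i j)
R-≤-suc u i j = subst (R u i (suc j) ≤_) (+-comm (R u i j) 1) (+-monoʳ-≤ (R u i j) (indicator≤1 _))

R-mono-suc : ∀ u i j → R u i j ≤ R u i (suc j)
R-mono-suc u i j = m≤m+n _ _

R-yes : ∀ u i j → u (suc j) ≤ i → R u i (suc j) ≡ suc (R u i j)
R-yes u i j p rewrite ≤⇒true p = +-comm (R u i j) 1

R-no : ∀ u i j → ¬ u (suc j) ≤ i → R u i (suc j) ≡ R u i j
R-no u i j p rewrite ≰⇒false p = +-identityʳ (R u i j)

R-swap-yes : ∀ u i a → u (suc (suc a)) ≤ i → R (u ∘ sℕ (suc a)) i (suc a) ≡ suc (R u i a)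
R-swap-yes u i a p =
  trans (R-yes (u ∘ sℕ (suc a)) i a (subst (_≤ i) (cong u (sym (sℕ-left (suc a)))) p))
        (cong suc (R-swap u i {suc a} {a} (s≤s z≤n) (1+n≢n ∘ sym)))

R-swap-no : ∀ u i a → ¬ u (suc (suc a)) ≤ i → R (u ∘ sℕ (suc a)) i (suc a) ≡ R u i a
R-swap-no u i a p =
  trans (R-no (u ∘ sℕ (suc a)) i a (p ∘ subst (_≤ i) (cong u (sℕ-left (suc a)))))
        (R-swap u i {suc a} {a} (s≤s z≤n) (1+n≢n ∘ sym))

R-demazure : ∀ n W i {a j} → 1 ≤ a → j ≢ a → R (demazure n (W ∷ʳ a)) i j ≡ R (demazure n W) i j
R-demazure n W i {a} {j} 1≤a j≢a =
  demazure-preserves (λ δ → R δ i j ≡ R (demazure n W) i j) n W a refl (R-swap (demazure n W) i 1≤a j≢a)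

≰-<-trans : ∀ {a b i} → ¬ a ≤ i → a < b → ¬ b ≤ i
≰-<-trans p q r = p (≤-trans (<⇒≤ q) r)

-- After the letter `k = suc a` the product has a descent at `k`. If its value at `k` is at most
-- `i`, so is the value at `k + 1`, and column `k + 1` counts one more; otherwise column `k` adds
-- nothing to column `k - 1`. In both of these columns the old and the new product have the same
-- `R`.
R-demazure-at : ∀ n W i r {a} → suc a < n → r ≤ R (demazure n (W ∷ʳ suc a)) i (suc a) →
  r ≤ R (demazure n W) i a ⊎ suc r ≤ R (demazure n W) i (suc (suc a))
R-demazure-at n W i r {a} a<n r≤ with <-cmp (demazure n W (suc a)) (demazure n W (suc (suc a)))
... | tri≈ _ eq _ = contradiction (demazure-injective n W eq) (1+n≢n ∘ sym)
... | tri< lt _ _ rewrite demazure-ascent W (s≤s z≤n) a<n lt = go (demazure n W) lt r≤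
  where
  go : ∀ u → u (suc a) < u (suc (suc a)) → r ≤ R (u ∘ sℕ (suc a)) i (suc a) →
    r ≤ R u i a ⊎ suc r ≤ R u i (suc (suc a))
  go u lt r≤ with u (suc (suc a)) ≤? i
  ... | yes p = inj₂ (subst (suc r ≤_)
                  (sym (trans (R-yes u i (suc a) p) (cong suc (R-yes u i a (≤-trans (<⇒≤ lt) p)))))
                  (s≤s (subst (r ≤_) (R-swap-yes u i a p) r≤)))
  ... | no ¬p = inj₁ (subst (r ≤_) (R-swap-no u i a ¬p) r≤)
R-demazure-at n W i r {a} a<n r≤
    | tri> _ _ gt rewrite demazure-descent W (s≤s z≤n) a<n gt = go (demazure n W) gt r≤
  where
  go : ∀ u → u (suc (suc a)) < u (suc a) → r ≤ R u i (suc a) →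
    r ≤ R u i a ⊎ suc r ≤ R u i (suc (suc a))
  go u gt r≤ with u (suc a) ≤? i
  ... | yes p = inj₂ (subst (suc r ≤_) (sym (R-yes u i (suc a) (≤-trans (<⇒≤ gt) p))) (s≤s r≤))
  ... | no ¬p = inj₁ (subst (r ≤_) (R-no u i a ¬p) r≤)

-- The subword property

-- Base of the subword induction. At `(i , i)` the identity attains the count `i`, which forces
-- `x i ≤ i`; injectivity then fixes the values one after the other from below.
R-id-minimal : ∀ {n x} → Injective x → x 0 ≡ 0 → (∀ i j → i ≤ n → j ≤ n → R id i j ≤ R x i j) →
  ∀ k → k ≤ n → k ≡ x k
R-id-minimal {n} {x} inj x0 dom = <-rec _ step
  where
  x≤ : ∀ i → 1 ≤ i → i ≤ n → x i ≤ i
  x≤ i 1≤i i≤n with x i ≤? i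
  ... | yes p = p
  ... | no ¬p = contradiction (dom i i i≤n i≤n) (<⇒≱ lt)
    where
    lt : R x i i < R id i i
    lt = cnt-mono-< i (λ k _ k≤i _ → ≤⇒true k≤i) i 1≤i ≤-refl (¬p ∘ true⇒≤) (≤⇒true {i} ≤-refl)
  step : ∀ k → (∀ {l} → l < k → l ≤ n → l ≡ x l) → k ≤ n → k ≡ x k
  step zero _ _ = sym x0
  step k@(suc _) ih k≤n with x k ≟ k
  ... | yes eq = sym eq
  ... | no ne = contradiction
    (inj (sym (ih xk<k (≤-trans (<⇒≤ xk<k) k≤n)))) ne
    where
    xk<k : x k < k
    xk<k = ≤∧≢⇒< (x≤ k (s≤s z≤n) k≤n) ne

filterᵇ-cong : ∀ {A : Set} {P P' : A → Bool} L → (∀ {y} → y ∈ L → P y ≡ P' y) → filterᵇ P L ≡ filterᵇ P' L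
filterᵇ-cong [] _ = refl
filterᵇ-cong {P = P} {P'} (x ∷ L) eq with P x | P' x | eq (here refl)
... | true  | .true  | refl = cong (x ∷_) (filterᵇ-cong L (eq ∘ there))
... | false | .false | refl = filterᵇ-cong L (eq ∘ there)

Unique-∷ʳ⁻ : ∀ {A : Set} {a : A} L → Unique (L ∷ʳ a) → Unique L × a ∉ L
Unique-∷ʳ⁻ [] _ = [] , λ ()
Unique-∷ʳ⁻ (x ∷ L) (x≢ ∷ u) with uL , a∉ ← Unique-∷ʳ⁻ L u with x≢L , x≢a ∷ [] ← All.++⁻ L x≢ =
  (x≢L ∷ uL) , λ { (here a≡x) → x≢a (sym a≡x) ; (there a∈) → a∉ a∈ }

-- Subwords are chosen by sets of elements of `A` rather than of letters, because labels repeat. The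
-- elements of the list are distinct, so the choice at the last one can be altered without touching
-- the others.
module Subword {A : Set} (_≟ᴬ_ : (x y : A) → Dec (x ≡ y)) (lab : A → ℕ) (n : ℕ) where

  word : (A → Bool) → List A → List ℕ
  word P L = map lab (filterᵇ P L)

  word-∷ʳ : ∀ P L a → word P (L ∷ʳ a) ≡ (if P a then word P L ∷ʳ lab a else word P L)
  word-∷ʳ P L a rewrite filter-++ (T? ∘ P) L (a ∷ []) with P a
  ... | true = map-++ lab (filterᵇ P L) (a ∷ [])
  ... | false = trans (map-++ lab (filterᵇ P L) []) (++-identityʳ _)

  update : A → Bool → (A → Bool) → A → Bool
  update a b P y with y ≟ᴬ a
  ... | yes _ = b
  ... | no _ = P y

  update-at : ∀ a b P → update a b P a ≡ b
  update-at a b P with a ≟ᴬ a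
  ... | yes _ = refl
  ... | no p = contradiction refl p

  update-other : ∀ {a} b P L → a ∉ L → ∀ {y} → y ∈ L → update a b P y ≡ P y
  update-other {a} b P L a∉L {y} y∈ with y ≟ᴬ a
  ... | yes refl = contradiction y∈ a∉L
  ... | no _ = refl

  word-update : ∀ {a} b P L → a ∉ L →
    word (update a b P) (L ∷ʳ a) ≡ (if b then word P L ∷ʳ lab a else word P L)
  word-update {a} b P L a∉L
    rewrite word-∷ʳ (update a b P) L a | update-at a b P
          | filterᵇ-cong {P = update a b P} {P} L (update-other b P L a∉L) = refl

  -- The lifting property of Bruhat order, applied to the last letter `a`: if `x` has an ascent at
  -- `a`, the letter is dropped; if a descent, it is kept and `x ∘ sℕ a` is sought in the shorter
  -- word.
  subword : ∀ L → Unique L → All (λ a → 1 ≤ lab a × lab a < n) L →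
    ∀ x → Injective x → x 0 ≡ 0 →
    (∀ i j → i ≤ n → j ≤ n → R (demazure n (map lab L)) i j ≤ R x i j) →
    Σ (A → Bool) λ P → ∀ k → k ≤ n → demazure n (word P L) k ≡ x k
  subword L = go (reverseView L)
    where
    go : ∀ {L} → Reverse L → Unique L → All (λ a → 1 ≤ lab a × lab a < n) L →
      ∀ x → Injective x → x 0 ≡ 0 →
      (∀ i j → i ≤ n → j ≤ n → R (demazure n (map lab L)) i j ≤ R x i j) →
      Σ (A → Bool) λ P → ∀ k → k ≤ n → demazure n (word P L) k ≡ x k
    go []ʳ _ _ x inj x0 dom = (λ _ → false) , R-id-minimal inj x0 dom
    go (L ∶ rev ∶ʳ b) uniq valid x inj x0 dom
      rewrite map-++ lab L (b ∷ [])
      with uL , b∉ ← Unique-∷ʳ⁻ L uniq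
         | vL , (1≤a , a<n) ∷ [] ← All.++⁻ L valid
      = main (lab b) refl 1≤a a<n
      where
      main : ∀ a → lab b ≡ a → 1 ≤ a → a < n →
        Σ (A → Bool) λ P → ∀ k → k ≤ n → demazure n (word P (L ∷ʳ b)) k ≡ x k
      main a@(suc a₀) lab≡ 1≤a a<n = result
        where
        u : ℕ → ℕ
        u = demazure n (map lab L)
        -- Column `a` is the only one where the last letter can change `R`. There the inequality for
        -- the previous product is recovered from the columns `a - 1` (`at-yes`) and `a + 1`
        -- (`at-no`).
        dom' : ∀ i j → i ≤ n → j ≤ n → j ≢ a → R u i j ≤ R x i j
        dom' i j i≤n j≤n j≢a =
          subst (_≤ R x i j) (R-demazure n (map lab L) i 1≤a j≢a)
            (subst (λ l → R (demazure n (map lab L ∷ʳ l)) i j ≤ R x i j) lab≡ (dom i j i≤n j≤n))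
        at-yes : ∀ {i} → i ≤ n → R u i a ≤ suc (R x i a₀)
        at-yes {i} i≤n = ≤-trans (R-≤-suc u i a₀)
          (s≤s (dom' i a₀ i≤n (≤-trans (n≤1+n _) (<⇒≤ a<n)) (1+n≢n ∘ sym)))
        at-no : ∀ {i} → i ≤ n → ¬ x a ≤ i → ¬ x (suc a) ≤ i → R u i a ≤ R x i a₀
        at-no {i} i≤n ¬p ¬q = ≤-trans (R-mono-suc u i a)
          (subst (R u i (suc a) ≤_) (trans (R-no x i a ¬q) (R-no x i a₀ ¬p)) (dom' i (suc a) i≤n a<n 1+n≢n))
        result : Σ (A → Bool) λ P → ∀ k → k ≤ n → demazure n (word P (L ∷ʳ b)) k ≡ x k
        result with <-cmp (x a) (x (suc a))
        ... | tri≈ _ eq _ = contradiction (inj eq) (1+n≢n ∘ sym)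
        ... | tri< lt _ _ = update b false P ,
              λ k k≤n → trans (cong (λ W → demazure n W k) (word-update false P L b∉)) (eqP k k≤n)
          where
          domx : ∀ i j → i ≤ n → j ≤ n → R u i j ≤ R x i j
          domx i j i≤n j≤n with j ≟ a
          ... | no j≢a = dom' i j i≤n j≤n j≢a
          ... | yes refl with x a ≤? i
          ...   | yes p = subst (R u i a ≤_) (sym (R-yes x i a₀ p)) (at-yes i≤n)
          ...   | no ¬p = subst (R u i a ≤_) (sym (R-no x i a₀ ¬p)) (at-no i≤n ¬p (≰-<-trans ¬p lt))
          ih = go rev uL vL x inj x0 domx
          P = proj₁ ih
          eqP = proj₂ ih
        ... | tri> _ _ gt = update b true P ,
              λ k k≤n → trans (cong (λ W → demazure n W k)
                                (trans (word-update true P L b∉) (cong (word P L ∷ʳ_) lab≡)))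
                       (trans (cong-app (demazure-ascent (word P L) 1≤a a<n asc) k)
                       (trans (eqP (sℕ a k) (s≤n k k≤n)) (cong x (sℕ-involutive a k))))
          where
          x' : ℕ → ℕ
          x' = x ∘ sℕ a
          domx : ∀ i j → i ≤ n → j ≤ n → R u i j ≤ R x' i j
          domx i j i≤n j≤n with j ≟ a
          ... | no j≢a = subst (R u i j ≤_) (sym (R-swap x i 1≤a j≢a)) (dom' i j i≤n j≤n j≢a)
          ... | yes refl with x (suc a) ≤? i
          ...   | yes p = subst (R u i a ≤_) (sym (R-swap-yes x i a₀ p)) (at-yes i≤n)
          ...   | no ¬p = subst (R u i a ≤_) (sym (R-swap-no x i a₀ ¬p)) (at-no i≤n (≰-<-trans ¬p gt) ¬p)
          ih = go rev uL vL x' (sℕ-injective a ∘ inj) (trans (cong x (sℕ-other {a} (λ ()) (λ ()))) x0) domx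
          P = proj₁ ih
          eqP = proj₂ ih
          s≤n : ∀ k → k ≤ n → sℕ a k ≤ n
          s≤n k k≤n with swapView a k
          ... | left = subst (_≤ n) (sym (sℕ-left a)) a<n
          ... | right = subst (_≤ n) (sym (sℕ-right a)) (<⇒≤ a<n)
          ... | other p q = subst (_≤ n) (sym (sℕ-other p q)) k≤n
          asc : demazure n (word P L) a < demazure n (word P L) (suc a)
          asc = subst₂ _<_ (sym (trans (eqP a (<⇒≤ a<n)) (cong x (sℕ-left a))))
                           (sym (trans (eqP (suc a) a<n) (cong x (sℕ-right a)))) gt

-- Lexicographically maximal matchings

-- Zero, one or variable. The variables being distinct, the kinds and positions of the entries
-- determine the products and their order.
data Entry : Set where
  O I V : Entry

V≢O : V ≢ O
V≢O ()

I≢O : I ≢ O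
I≢O ()

Edge : Set
Edge = ℕ × ℕ

Pattern : Set
Pattern = Edge → Entry

rowsOf colsOf : List Edge → List ℕ
rowsOf = map proj₁
colsOf = map proj₂

_≺_ : Edge → Edge → Set
(i , j) ≺ (k , l) = j < l ⊎ (j ≡ l × k < i)

Supported : Pattern → List Edge → Set
Supported Z = All (λ e → Z e ≢ O)

-- The lexicographic term order read on matchings. Products are squarefree, so the largest variable
-- contained in only one of `τ` and `σ` decides. Unit entries contribute no variable and are left
-- out of the comparison.
record Beats (Z : Pattern) (τ σ : List Edge) : Set where
  constructor beats
  field
    edge  : Edge
    var   : Z edge ≡ V
    in-τ  : edge ∈ τ
    out-σ : edge ∉ σ
    above : ∀ e → Z e ≡ V → edge ≺ e → (e ∈ τ → e ∈ σ) × (e ∈ σ → e ∈ τ)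

record Maximal (Z : Pattern) (σ : List Edge) : Set where
  field
    unique-rows : Unique (rowsOf σ)
    unique-cols : Unique (colsOf σ)
    supported   : Supported Z σ
    maximal     : ∀ τ → rowsOf τ ↭ rowsOf σ → colsOf τ ↭ colsOf σ → Supported Z τ → ¬ Beats Z τ σ

Unique-resp-↭ : ∀ {A : Set} {xs ys : List A} → xs ↭ ys → Unique xs → Unique ys
Unique-resp-↭ {A} p = Permutationₛ.Unique-resp-↭ (setoid A) (↭⇒↭ₛ p)

∈⇒↭∷ : ∀ {A : Set} {x : A} {xs} → x ∈ xs → Σ (List A) λ ys → xs ↭ x ∷ ys
∈⇒↭∷ {x = x} x∈ with ys , zs , refl ← ∈-∃++ x∈ = ys ++ zs , shift x ys zs

∈⇒length≢0 : ∀ {A : Set} {x : A} {xs} → x ∈ xs → length xs ≢ 0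
∈⇒length≢0 (here _) ()
∈⇒length≢0 (there _) ()

Unique-map-injective : ∀ {A B : Set} (f : A → B) {xs x y} → Unique (map f xs) →
  x ∈ xs → y ∈ xs → f x ≡ f y → x ≡ y
Unique-map-injective f _ (here refl) (here refl) _ = refl
Unique-map-injective f (fx∉ ∷ _) (here refl) (there y∈) eq =
  contradiction eq (All.lookup fx∉ (∈-map⁺ f y∈))
Unique-map-injective f (fy∉ ∷ _) (there x∈) (here refl) eq =
  contradiction (sym eq) (All.lookup fy∉ (∈-map⁺ f x∈))
Unique-map-injective f (_ ∷ u) (there x∈) (there y∈) eq = Unique-map-injective f u x∈ y∈ eq

Unique-∷⇒∉ : ∀ {A : Set} {x : A} {xs} → Unique (x ∷ xs) → x ∉ xs
Unique-∷⇒∉ (x≢ ∷ _) x∈ = All.lookup x≢ x∈ refl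

∉⇒Unique-∷ : ∀ {A : Set} {x : A} {xs} → x ∉ xs → Unique xs → Unique (x ∷ xs)
∉⇒Unique-∷ x∉ u = All.tabulate (λ { y∈ refl → x∉ y∈ }) ∷ u

Maximal-resp-↭ : ∀ {Z σ ρ} → σ ↭ ρ → Maximal Z σ → Maximal Z ρ
Maximal-resp-↭ {Z} {σ} {ρ} p M = record
  { unique-rows = Unique-resp-↭ (↭-map⁺ proj₁ p) unique-rows
  ; unique-cols = Unique-resp-↭ (↭-map⁺ proj₂ p) unique-cols
  ; supported   = All-resp-↭ p supported
  ; maximal     = λ { τ pr pc s (beats e v e∈ e∉ ab) →
      maximal τ (↭-trans pr (↭-map⁺ proj₁ (↭-sym p))) (↭-trans pc (↭-map⁺ proj₂ (↭-sym p))) s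
        (beats e v e∈ (e∉ ∘ ∈-resp-↭ p) λ e' v' lt →
          (∈-resp-↭ (↭-sym p) ∘ proj₁ (ab e' v' lt)) , (proj₂ (ab e' v' lt) ∘ ∈-resp-↭ p)) }
  }
  where open Maximal M

-- A better matching of the remaining rows and columns would, with `e` put back, beat the whole.
Maximal-tail : ∀ {Z e σ} → Maximal Z (e ∷ σ) → Maximal Z σ
Maximal-tail {Z} {e} {σ} M with Maximal.unique-rows M | Maximal.unique-cols M | Maximal.supported M
... | ur@(_ ∷ ur') | _ ∷ uc' | s ∷ ss = record
  { unique-rows = ur'
  ; unique-cols = uc'
  ; supported   = ss
  ; maximal     = λ { τ pr pc sτ (beats e₀ v e₀∈ e₀∉ ab) →
      Maximal.maximal M (e ∷ τ) (prep _ pr) (prep _ pc) (s ∷ sτ)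
        (beats e₀ v (there e₀∈)
          (λ { (here refl) → Unique-∷⇒∉ ur (∈-resp-↭ pr (∈-map⁺ proj₁ e₀∈))
             ; (there e₀∈σ) → e₀∉ e₀∈σ })
          λ e' v' lt →
            (λ { (here eq) → here eq ; (there q) → there (proj₁ (ab e' v' lt) q) }) ,
            (λ { (here eq) → here eq ; (there q) → there (proj₂ (ab e' v' lt) q) })) }
  }

-- Every competitor has to cover column `q` by `(p , q)`, its only nonzero entry; removing that edge
-- leaves a competitor of `σ`.
Maximal-∷ : ∀ {Z σ p q} → p ∉ rowsOf σ → q ∉ colsOf σ →
  Z (p , q) ≢ O → (∀ r → Z (r , q) ≢ O → r ≡ p) → Maximal Z σ → Maximal Z ((p , q) ∷ σ)
Maximal-∷ {Z} {σ} {p} {q} p∉ q∉ pq only M = record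
  { unique-rows = ∉⇒Unique-∷ p∉ unique-rows
  ; unique-cols = ∉⇒Unique-∷ q∉ unique-cols
  ; supported   = pq ∷ supported
  ; maximal     = max
  }
  where
  open Maximal M
  max : ∀ τ → rowsOf τ ↭ p ∷ rowsOf σ → colsOf τ ↭ q ∷ colsOf σ → Supported Z τ → ¬ Beats Z τ ((p , q) ∷ σ)
  max τ pr pc sτ (beats e v e∈ e∉ ab)
    with (r , _) , rq∈ , refl ← ∈-map⁻ proj₂ (∈-resp-↭ (↭-sym pc) (here refl))
    with refl ← only r (All.lookup sτ rq∈)
    with τ₁ , τ↭ ← ∈⇒↭∷ rq∈ =
      maximal τ₁ pr₁ (drop-∷ (↭-trans (↭-map⁺ proj₂ (↭-sym τ↭)) pc))
        (All.tail (All-resp-↭ τ↭ sτ))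
        (beats e v (old (∈-resp-↭ τ↭ e∈)) (e∉ ∘ there) λ e' v' lt →
          (λ e'∈ → old' e'∈ (proj₁ (ab e' v' lt) (∈-resp-↭ (↭-sym τ↭) (there e'∈)))) ,
          (λ e'∈ → old'' e'∈ (∈-resp-↭ τ↭ (proj₂ (ab e' v' lt) (there e'∈)))))
    where
    pr₁ : rowsOf τ₁ ↭ rowsOf σ
    pr₁ = drop-∷ (↭-trans (↭-map⁺ proj₁ (↭-sym τ↭)) pr)
    old : e ∈ (p , q) ∷ τ₁ → e ∈ τ₁
    old (here eq) = contradiction (here eq) e∉
    old (there x) = x
    old' : ∀ {e'} → e' ∈ τ₁ → e' ∈ (p , q) ∷ σ → e' ∈ σ
    old' e'∈ (here refl) = contradiction (∈-resp-↭ pr₁ (∈-map⁺ proj₁ e'∈)) p∉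
    old' e'∈ (there x) = x
    old'' : ∀ {e'} → e' ∈ σ → e' ∈ (p , q) ∷ τ₁ → e' ∈ τ₁
    old'' e'∈ (here refl) = contradiction (∈-map⁺ proj₁ e'∈) p∉
    old'' e'∈ (there x) = x

record Inside (i j : ℕ) (e : Edge) : Set where
  constructor inside
  field
    row≥1 : 1 ≤ proj₁ e
    row≤  : proj₁ e ≤ i
    col≥1 : 1 ≤ proj₂ e
    col≤  : proj₂ e ≤ j

open Inside

-- `S` constrains the variables only: a unit entry leaves no trace in the leading monomial and may
-- be used freely.
record Good (Z : Pattern) (S : Edge → Bool) (i j r : ℕ) (σ : List Edge) : Set where
  field
    isMaximal : Maximal Z σ
    size      : length σ ≡ r
    within    : All (Inside i j) σ
    chosen    : All (λ e → Z e ≡ V → S e ≡ true) σ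
  open Maximal isMaximal public

Good-resp-↭ : ∀ {Z S i j r σ ρ} → σ ↭ ρ → Good Z S i j r σ → Good Z S i j r ρ
Good-resp-↭ p G = record
  { isMaximal = Maximal-resp-↭ p isMaximal
  ; size      = trans (sym (↭-length p)) size
  ; within    = All-resp-↭ p within
  ; chosen    = All-resp-↭ p chosen
  }
  where open Good G

Good-tail : ∀ {Z S i j r e σ} → Good Z S i j (suc r) (e ∷ σ) → Good Z S i j r σ
Good-tail G = record
  { isMaximal = Maximal-tail isMaximal
  ; size      = suc-injective size
  ; within    = All.tail within
  ; chosen    = All.tail chosen
  }
  where open Good G

Good-widen : ∀ {Z S i j j' r σ} → All (λ e → proj₂ e ≤ j') σ → Good Z S i j r σ → Good Z S i j' r σ
Good-widen b G = record
  { isMaximal = isMaximal ; size = size ; chosen = chosen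
  ; within = All.zipWith (λ { (c≤ , inside a b c _) → inside a b c c≤ }) (b , within) }
  where open Good G

-- One step v' = v s_k: column k of Z' is the p-th unit vector and becomes column k + 1 of Z, whereas
-- column k of Z is column k + 1 of Z' with its zero in row p replaced by a new variable.

record Step (Z' Z : Pattern) (S' S : Edge → Bool) (p k : ℕ) : Set where
  field
    1≤p   : 1 ≤ p
    1≤k   : 1 ≤ k
    agree : ∀ r c → ¬ (r ≡ p × c ≡ suc k) → Z (r , sℕ k c) ≡ Z' (r , c)
    old   : Z' (p , suc k) ≡ O
    new   : Z (p , k) ≡ V
    unit  : Z' (p , k) ≡ I
    only  : ∀ r → Z' (r , k) ≢ O → r ≡ p
    low   : ∀ r → r < p → Z (r , k) ≡ O
    agreeS : ∀ r c → S' (r , c) ≡ S (r , sℕ k c)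

-- Carrying maximal matchings across one column exchange.

module _ {Z' Z S' S p k} (step : Step Z' Z S' S p k) where
  open Step step

  swapCols : List Edge → List Edge
  swapCols = map λ { (r , c) → r , sℕ k c }

  rows-swapCols : ∀ σ → rowsOf (swapCols σ) ≡ rowsOf σ
  rows-swapCols σ = sym (map-∘ σ)

  cols-swapCols : ∀ σ → colsOf (swapCols σ) ≡ map (sℕ k) (colsOf σ)
  cols-swapCols σ = trans (sym (map-∘ σ)) (map-∘ σ)

  swap-involutive : ∀ xs → map (sℕ k) (map (sℕ k) xs) ≡ xs
  swap-involutive xs = trans (sym (map-∘ xs)) (trans (map-cong (sℕ-involutive k) xs) (map-id xs))

  ∈-swapCols : ∀ {r c σ} → (r , c) ∈ σ → (r , sℕ k c) ∈ swapCols σ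
  ∈-swapCols = ∈-map⁺ _

  ∈-swapCols⁻ : ∀ {r c σ} → (r , c) ∈ swapCols σ → (r , sℕ k c) ∈ σ
  ∈-swapCols⁻ {r} x with (_ , c) , c∈ , refl ← ∈-map⁻ _ x =
    subst (λ c → (r , c) ∈ _) (sym (sℕ-involutive k c)) c∈

  ∈-swapCols⁻′ : ∀ {r c σ} → (r , sℕ k c) ∈ swapCols σ → (r , c) ∈ σ
  ∈-swapCols⁻′ {r} {c} x = subst (λ c → (r , c) ∈ _) (sℕ-involutive k c) (∈-swapCols⁻ x)

  agree⁻ : ∀ r c → ¬ (r ≡ p × c ≡ k) → Z (r , c) ≡ Z' (r , sℕ k c)
  agree⁻ r c ne = trans (cong (λ c → Z (r , c)) (sym (sℕ-involutive k c)))
                        (agree r (sℕ k c) λ { (e , e') → ne (e , sℕ-left⁻ e') })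

  not-old : ∀ {r c} → Z' (r , c) ≢ O → ¬ (r ≡ p × c ≡ suc k)
  not-old nz (refl , refl) = nz old

  V-col≢k : ∀ {r} → Z' (r , k) ≢ V
  V-col≢k {r} v with refl ← only r (λ o → V≢O (trans (sym v) o)) with () ← trans (sym unit) v

  -- The entry at `(p , k)` is the one place where `Z` differs from `Z'` with its columns exchanged.
  -- Competitors that do without it correspond to supported matchings of `Z'`.
  Avoiding : List Edge → Set
  Avoiding σ = ∀ τ → rowsOf τ ↭ rowsOf σ → colsOf τ ↭ map (sℕ k) (colsOf σ) → Supported Z τ → (p , k) ∉ τ

  Maximal-swapCols : ∀ {σ} → Avoiding σ → Maximal Z' σ → Maximal Z (swapCols σ)
  Maximal-swapCols {σ} avoid M = record
    { unique-rows = subst Unique (sym (rows-swapCols σ)) unique-rows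
    ; unique-cols = subst Unique (sym (cols-swapCols σ)) (Unique.map⁺ (sℕ-injective k) unique-cols)
    ; supported   = All.map⁺ (All.map (λ {e} nz → subst (_≢ O) (sym (agree (proj₁ e) (proj₂ e) (not-old nz))) nz) supported)
    ; maximal     = max
    }
    where
    open Maximal M
    max : ∀ τ → rowsOf τ ↭ rowsOf (swapCols σ) → colsOf τ ↭ colsOf (swapCols σ) →
      Supported Z τ → ¬ Beats Z τ (swapCols σ)
    max τ pr pc sτ (beats (a , b) v e∈ e∉ ab) =
      maximal (swapCols τ)
        (subst₂ _↭_ (sym (rows-swapCols τ)) (rows-swapCols σ) pr)
        (subst₂ _↭_ (sym (cols-swapCols τ)) (trans (cong (map (sℕ k)) (cols-swapCols σ)) (swap-involutive (colsOf σ)))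
          (↭-map⁺ (sℕ k) pc))
        (All.map⁺ (All.tabulate λ { {r , c} e∈ o → All.lookup sτ e∈ (trans (agree⁻ r c (avoided e∈)) o) }))
        (beats (a , sℕ k b) v' (∈-swapCols e∈) (e∉ ∘ λ x → subst (λ b → (a , b) ∈ swapCols σ) (sℕ-involutive k b) (∈-swapCols x))
          λ { (c , d) w lt → let f , g = ab (c , sℕ k d) (trans (agree c d (not-old λ o → V≢O (trans (sym w) o))) w) (order w lt)
              in (λ x → ∈-swapCols⁻′ (f (∈-swapCols⁻ x))) ,
                 (λ x → subst (λ d → (c , d) ∈ swapCols τ) (sℕ-involutive k d) (∈-swapCols (g (∈-swapCols x)))) })
      where
      avoided : ∀ {r c} → (r , c) ∈ τ → ¬ (r ≡ p × c ≡ k)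
      avoided x (refl , refl) =
        avoid τ (subst (rowsOf τ ↭_) (rows-swapCols σ) pr) (subst (colsOf τ ↭_) (cols-swapCols σ) pc) sτ x
      v' : Z' (a , sℕ k b) ≡ V
      v' = trans (sym (agree⁻ a b (avoided e∈))) v
      -- `sℕ k` could reverse two variables only if the smaller one lay in column `k` of `Z'`, and
      -- that column holds no variable.
      order : ∀ {c d} → Z' (c , d) ≡ V → (a , sℕ k b) ≺ (c , d) → (a , b) ≺ (c , sℕ k d)
      order {d = d} w (inj₁ lt) = inj₁ (subst (_< sℕ k d) (sℕ-involutive k b)
        (sℕ-mono-< k lt λ e _ → V-col≢k (subst (λ b → Z' (a , b) ≡ V) e v')))
      order w (inj₂ (refl , lt)) = inj₂ (sym (sℕ-involutive k b) , lt)

  sℕ≥1 : ∀ {c} → 1 ≤ c → 1 ≤ sℕ k c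
  sℕ≥1 {c} 1≤c with swapView k c
  ... | left = subst (1 ≤_) (sym (sℕ-left k)) (s≤s z≤n)
  ... | right = subst (1 ≤_) (sym (sℕ-right k)) 1≤k
  ... | other a b = subst (1 ≤_) (sym (sℕ-other a b)) 1≤c

  Good-swapCols : ∀ {i j j' r σ} → Avoiding σ → All (λ e → sℕ k (proj₂ e) ≤ j') σ →
    Good Z' S' i j r σ → Good Z S i j' r (swapCols σ)
  Good-swapCols {σ = σ} avoid bound G = record
    { isMaximal = Maximal-swapCols avoid isMaximal
    ; size      = trans (length-map _ σ) size
    ; within    = All.map⁺ (All.zipWith (λ { (b , inside x y z _) → inside x y (sℕ≥1 z) b }) (bound , within))
    ; chosen    = All.map⁺ (All.zipWith (λ { {r , c} (ch , nz) v →
                    trans (sym (agreeS r c)) (ch (trans (sym (agree r c (not-old nz))) v)) }) (chosen , supported))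
    }
    where open Good G

  avoid-row : ∀ {σ} → p ∉ rowsOf σ → Avoiding σ
  avoid-row p∉ τ pr pc sτ x = p∉ (∈-resp-↭ pr (∈-map⁺ proj₁ x))

  avoid-col : ∀ {σ} → suc k ∉ colsOf σ → Avoiding σ
  avoid-col {σ} k∉ τ pr pc sτ x with c , c∈ , eq ← ∈-map⁻ _ (∈-resp-↭ pc (∈-map⁺ proj₂ x)) =
    k∉ (subst (_∈ colsOf σ) (sℕ-right⁻ (sym eq)) c∈)

  only-new : ∀ r → Z (r , suc k) ≢ O → r ≡ p
  only-new r nz = only r (nz ∘ trans (agree⁻ r (suc k) (1+n≢n ∘ proj₂)) ∘ trans (cong (λ c → Z' (r , c)) (sℕ-right k)))

  unit-new : Z (p , suc k) ≡ I
  unit-new = trans (agree⁻ p (suc k) (1+n≢n ∘ proj₂)) (trans (cong (λ c → Z' (p , c)) (sℕ-right k)) unit)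

  -- A competitor then has to cover column `k + 1` of `Z`, a unit vector, by `(p , suc k)`, and row
  -- `p` is no longer free for `(p , k)`.
  avoid-unit : ∀ {σ} → Unique (rowsOf σ) → k ∈ colsOf σ → Avoiding σ
  avoid-unit {σ} u k∈ τ pr pc sτ x
    with (r , _) , rk∈ , refl ← ∈-map⁻ proj₂ (∈-resp-↭ (↭-sym pc) (subst (_∈ map (sℕ k) (colsOf σ)) (sℕ-left k) (∈-map⁺ (sℕ k) k∈)))
    with refl ← only-new r (All.lookup sτ rk∈)
    = 1+n≢n (cong proj₂ (Unique-map-injective proj₁ (Unique-resp-↭ (↭-sym pr) u) rk∈ x refl))

  sℕ≤ : ∀ {c j} → j ≢ k → c ≤ j → sℕ k c ≤ j
  sℕ≤ {c} {j} j≢k c≤j with swapView k c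
  ... | left = subst (_≤ j) (sym (sℕ-left k)) (≤∧≢⇒< c≤j (j≢k ∘ sym))
  ... | right = subst (_≤ j) (sym (sℕ-right k)) (≤-trans (n≤1+n k) c≤j)
  ... | other a b = subst (_≤ j) (sym (sℕ-other a b)) c≤j

  -- For `j ≢ k` the columns `k` and `k + 1` are both within the bound `j` or both beyond it, so the
  -- exchange respects the bound.
  step-other : ∀ {i j r σ} → j ≢ k → Good Z' S' i j r σ → ∃ (Good Z S i j r)
  step-other {i} {j} {r} {σ} j≢k G with suc k ∈? colsOf σ | p ∈? rowsOf σ | k ∈? colsOf σ
  ... | no k+1∉ | _ | _ = _ , Good-swapCols (avoid-col k+1∉) (All.map (sℕ≤ j≢k ∘ col≤) (Good.within G)) G
  ... | yes _ | no p∉ | _ = _ , Good-swapCols (avoid-row p∉) (All.map (sℕ≤ j≢k ∘ col≤) (Good.within G)) G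
  ... | yes _ | yes _ | yes k∈ =
    _ , Good-swapCols (avoid-unit (Good.unique-rows G) k∈) (All.map (sℕ≤ j≢k ∘ col≤) (Good.within G)) G
  -- The entry of Z' at (p , k + 1) vanishes, so the matching uses row p at some other column c; trading
  -- (p , c) for the unit entry (p , k + 1) of Z keeps its size without using the new variable.
  ... | yes k+1∈ | yes p∈ | no k∉ with (_ , c) , pc∈ , refl ← ∈-map⁻ proj₁ p∈ = trade r (Good.size G) G
    where
    trade : ∀ r → length σ ≡ r → Good Z' S' i j r σ → ∃ (Good Z S i j r)
    trade zero eq _ = contradiction eq (∈⇒length≢0 pc∈)
    trade (suc r) _ G with ρ , σ↭ ← ∈⇒↭∷ pc∈ = (p , suc k) ∷ swapCols ρ , record
      { isMaximal = Maximal-∷ (p∉ ∘ subst (p ∈_) (rows-swapCols ρ))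
                              (k+1∉ ∘ subst (suc k ∈_) (cols-swapCols ρ))
                              (λ o → I≢O (trans (sym unit-new) o)) only-new isMaximal
      ; size      = cong suc size
      ; within    = inside 1≤p (row≤ (All.lookup (Good.within G) pc∈)) (s≤s z≤n) k+1≤j ∷ within
      ; chosen    = (λ v → contradiction (trans (sym unit-new) v) λ ()) ∷ chosen
      }
      where
      G₁ : Good Z' S' i j (suc r) ((p , c) ∷ ρ)
      G₁ = Good-resp-↭ σ↭ G
      p∉ : p ∉ rowsOf ρ
      p∉ = Unique-∷⇒∉ (Good.unique-rows G₁)
      k+1∉ : suc k ∉ map (sℕ k) (colsOf ρ)
      k+1∉ x with c , c∈ , eq ← ∈-map⁻ _ x =
        k∉ (∈-resp-↭ (↭-map⁺ proj₂ (↭-sym σ↭)) (there (subst (_∈ colsOf ρ) (sℕ-left⁻ (sym eq)) c∈)))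
      k+1≤j : suc k ≤ j
      k+1≤j with _ , x , refl ← ∈-map⁻ proj₂ k+1∈ = col≤ (All.lookup (Good.within G) x)
      open Good (Good-swapCols (avoid-row p∉) (All.map (sℕ≤ j≢k ∘ col≤) (Good.within (Good-tail G₁))) (Good-tail G₁))

  bounded′ : ∀ {σ} → All (λ e → proj₂ e ≤ suc k) σ → k ∉ colsOf σ → All (λ e → sℕ k (proj₂ e) ≤ k) σ
  bounded′ {σ} b k∉ = All.tabulate λ {e} e∈ → go (proj₂ e) (∈-map⁺ proj₂ e∈) (All.lookup b e∈)
    where
    go : ∀ c → c ∈ colsOf σ → c ≤ suc k → sℕ k c ≤ k
    go c c∈ c≤ with swapView k c
    ... | left = contradiction c∈ k∉
    ... | right = ≤-reflexive (sℕ-right k)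
    ... | other a b = subst (_≤ k) (sym (sℕ-other a b)) (≤-pred (≤∧≢⇒< c≤ b))

  -- One edge may be given up, and it is chosen so that the rest avoids the new variable and fits
  -- into the columns up to `k`: the unit `(p , k)` if column `k` is used, otherwise the edge in
  -- column `k + 1`, and any edge when neither column is used.
  step-out : ∀ {i r σ} → Good Z' S' i (suc k) (suc r) σ → ∃ (Good Z S i k r)
  step-out {i} {r} {σ} G with k ∈? colsOf σ | suc k ∈? colsOf σ
  ... | yes k∈ | _
    with (_ , _) , pk∈ , refl ← ∈-map⁻ proj₂ k∈
    with refl ← only _ (All.lookup (Good.supported G) pk∈)
    with ρ , σ↭ ← ∈⇒↭∷ pk∈
    = _ , Good-swapCols (avoid-row (Unique-∷⇒∉ (Good.unique-rows G₁)))
            (bounded′ (All.map col≤ (Good.within (Good-tail G₁))) (Unique-∷⇒∉ (Good.unique-cols G₁))) (Good-tail G₁)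
    where
    G₁ = Good-resp-↭ σ↭ G
  ... | no k∉ | yes k+1∈
    with (a , _) , e∈ , refl ← ∈-map⁻ proj₂ k+1∈
    with ρ , σ↭ ← ∈⇒↭∷ e∈
    = _ , Good-swapCols (avoid-col (Unique-∷⇒∉ (Good.unique-cols G₁)))
            (bounded′ (All.map col≤ (Good.within (Good-tail G₁)))
              (k∉ ∘ ∈-resp-↭ (↭-map⁺ proj₂ (↭-sym σ↭)) ∘ there)) (Good-tail G₁)
    where
    G₁ = Good-resp-↭ σ↭ G
  step-out {σ = []} G | no _ | no _ with () ← Good.size G
  step-out {σ = e ∷ σ} G | no k∉ | no k+1∉ =
    _ , Good-swapCols (avoid-col (k+1∉ ∘ there))
          (bounded′ (All.map col≤ (Good.within (Good-tail G))) (k∉ ∘ there)) (Good-tail G)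

  -- Here the bound stays at `k`. A matching through the unit at `(p , k)` is kept as it is, that
  -- edge now carrying a variable, which membership in `S` permits. All its other edges lie left of
  -- column `k`, where `Z` and `Z'` agree.
  step-in : ∀ {i r σ} → S (p , k) ≡ true → Good Z' S' i k r σ → ∃ (Good Z S i k r)
  step-in {i} {r} {σ} Spk G with k ∈? colsOf σ
  ... | no k∉ = _ , Good-swapCols (avoid-col (λ x → <⇒≱ ≤-refl (≤k x)))
                      (bounded′ (All.map (m≤n⇒m≤1+n ∘ col≤) (Good.within G)) k∉) G
    where
    ≤k : ∀ {c} → c ∈ colsOf σ → c ≤ k
    ≤k x with _ , y , refl ← ∈-map⁻ proj₂ x = col≤ (All.lookup (Good.within G) y)
  ... | yes k∈
    with (_ , _) , pk∈ , refl ← ∈-map⁻ proj₂ k∈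
    with refl ← only _ (All.lookup (Good.supported G) pk∈)
    = σ , record
      { isMaximal = record
        { unique-rows = unique-rows
        ; unique-cols = unique-cols
        ; supported = All.tabulate supp
        ; maximal = max
        }
      ; size = size
      ; within = within
      ; chosen = All.tabulate ch
      }
    where
    open Good G
    ≤k : ∀ {r c} → (r , c) ∈ σ → c ≤ k
    ≤k x = col≤ (All.lookup within x)
    same : ∀ {r c} → c < k → Z (r , c) ≡ Z' (r , c)
    same {r} {c} c<k = trans (cong (λ c → Z (r , c)) (sym (sℕ-other (<⇒≢ c<k) (<⇒≢ (m<n⇒m<1+n c<k)))))
                             (agree r c λ { (_ , refl) → <⇒≱ c<k (n≤1+n k) })
    pk⊎< : ∀ {τ r c} → Unique (colsOf τ) → (p , k) ∈ τ → (r , c) ∈ τ → c ≤ k → (r , c) ≡ (p , k) ⊎ c < k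
    pk⊎< {c = c} u pk∈ x c≤ with c ≟ k
    ... | yes eq = inj₁ (Unique-map-injective proj₂ u x pk∈ eq)
    ... | no ne = inj₂ (≤∧≢⇒< c≤ ne)
    supp : ∀ {e} → e ∈ σ → Z e ≢ O
    supp x with pk⊎< unique-cols pk∈ x (≤k x)
    ... | inj₁ refl = λ o → V≢O (trans (sym new) o)
    ... | inj₂ lt = λ o → All.lookup supported x (trans (sym (same lt)) o)
    ch : ∀ {e} → e ∈ σ → Z e ≡ V → S e ≡ true
    ch {r , c} x v with pk⊎< unique-cols pk∈ x (≤k x)
    ... | inj₁ refl = Spk
    ... | inj₂ lt = trans (cong (λ c → S (r , c)) (sym (sℕ-other (<⇒≢ lt) (<⇒≢ (m<n⇒m<1+n lt)))))
                     (trans (sym (agreeS r c)) (All.lookup chosen x (trans (sym (same lt)) v)))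
    max : ∀ τ → rowsOf τ ↭ rowsOf σ → colsOf τ ↭ colsOf σ → Supported Z τ → ¬ Beats Z τ σ
    max τ pr pc sτ (beats (a , b) v e∈ e∉ ab) = main
      where
      τ≤k : ∀ {r c} → (r , c) ∈ τ → c ≤ k
      τ≤k x with _ , y , refl ← ∈-map⁻ proj₂ (∈-resp-↭ pc (∈-map⁺ proj₂ x)) = col≤ (All.lookup within y)
      -- (p , k) is the largest variable in the columns up to k, so a matching without it cannot win.
      top : (p , k) ∈ τ
      top with b ≟ k
      ... | no b≢k = proj₂ (ab (p , k) new (inj₁ (≤∧≢⇒< (τ≤k e∈) b≢k))) pk∈
      ... | yes refl with <-cmp p a
      ...   | tri< lt _ _ = proj₂ (ab (p , k) new (inj₂ (refl , lt))) pk∈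
      ...   | tri≈ _ refl _ = e∈
      ...   | tri> _ _ gt = contradiction (trans (sym v) (low a gt)) V≢O
      uτ : Unique (colsOf τ)
      uτ = Unique-resp-↭ (↭-sym pc) unique-cols
      suppτ : ∀ {e} → e ∈ τ → Z' e ≢ O
      suppτ x with pk⊎< uτ top x (τ≤k x)
      ... | inj₁ refl = λ o → I≢O (trans (sym unit) o)
      ... | inj₂ lt = λ o → All.lookup sτ x (trans (same lt) o)
      -- The deciding edge cannot be `(p , k)`, which lies in both matchings, so it is a variable of
      -- `Z'` too and the comparison carries over.
      b<k : b < k
      b<k with pk⊎< uτ top e∈ (τ≤k e∈)
      ... | inj₁ refl = contradiction pk∈ e∉
      ... | inj₂ lt = lt
      above' : ∀ e → Z' e ≡ V → (a , b) ≺ e → (e ∈ τ → e ∈ σ) × (e ∈ σ → e ∈ τ)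
      above' (c , d) w lt with <-cmp d k
      ... | tri< d<k _ _ = ab (c , d) (trans (same d<k) w) lt
      ... | tri≈ _ refl _ = contradiction w V-col≢k
      ... | tri> _ _ gt = (λ x → contradiction (τ≤k x) (<⇒≱ gt)) , (λ x → contradiction (≤k x) (<⇒≱ gt))
      main : ⊥
      main = maximal τ pr pc (All.tabulate suppτ) (beats (a , b) (trans (sym (same b<k)) v) e∈ e∉ above')


-- Permutations of {1, …, n}, extended to ℕ by the identity

record Perm (n : ℕ) : Set where
  field
    to from : ℕ → ℕ
    from-to : ∀ x → from (to x) ≡ x
    to-from : ∀ x → to (from x) ≡ x
    to-zero : to 0 ≡ 0
    to-big  : ∀ x → n < x → to x ≡ x

  to-injective : Injective to
  to-injective {k} {l} eq = trans (sym (from-to k)) (trans (cong from eq) (from-to l))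

  from-injective : Injective from
  from-injective {k} {l} eq = trans (sym (to-from k)) (trans (cong to eq) (to-from l))

  from-fixed : ∀ {x} → to x ≡ x → from x ≡ x
  from-fixed {x} eq = trans (cong from (sym eq)) (from-to x)

  to-≤ : ∀ {x} → x ≤ n → to x ≤ n
  to-≤ {x} x≤n with to x ≤? n
  ... | yes p = p
  ... | no p = contradiction (subst (_≤ n) (sym (to-injective (to-big (to x) (≰⇒> p)))) x≤n) p

  from-≤ : ∀ {x} → x ≤ n → from x ≤ n
  from-≤ {x} x≤n with from x ≤? n
  ... | yes p = p
  ... | no p = contradiction (subst (_≤ n) (trans (sym (to-from x)) (to-big (from x) (≰⇒> p))) x≤n) p

  from-≥1 : ∀ {x} → 1 ≤ x → 1 ≤ from x
  from-≥1 {suc x} _ with from (suc x) in eq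
  ... | suc _ = s≤s z≤n
  ... | zero with () ← trans (sym (to-from (suc x))) (trans (cong to eq) to-zero)

letterIf : Bool → Bool → ℕ → List ℕ
letterIf b s a = if b ∧ not s then a ∷ [] else []

letterIf-cong : ∀ {b b' s s' a a'} → b ≡ b' → s ≡ s' → a ≡ a' → letterIf b s a ≡ letterIf b' s' a'
letterIf-cong refl refl refl = refl

-- Diagram, matrix and reading word of a permutation, and the removal of the last box.

module _ {n : ℕ} where
  open Perm

  -- The diagram of ρ; for ρ = w₀ v it is D(v).
  box : Perm n → ℕ → ℕ → Bool
  box ρ i j = (i <ᵇ to ρ j) ∧ (j <ᵇ from ρ i)

  box⁺ : ∀ ρ {i j} → i < to ρ j → j < from ρ i → box ρ i j ≡ true
  box⁺ ρ p q = ∧-true (<⇒true p) (<⇒true q)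

  box⁻ : ∀ ρ {i j} → box ρ i j ≡ true → i < to ρ j × j < from ρ i
  box⁻ ρ {i} {j} b with p , q ← ∧-true⁻ {i <ᵇ to ρ j} b = true⇒< p , true⇒< q

  box-false : ∀ ρ {i j} → (i < to ρ j → ¬ j < from ρ i) → box ρ i j ≡ false
  box-false ρ {i} {j} f with box ρ i j in eq
  ... | false = refl
  ... | true = contradiction (proj₂ (box⁻ ρ eq)) (f (proj₁ (box⁻ ρ eq)))

  matrix : Perm n → Pattern
  matrix ρ (i , j) = if i ≡ᵇ to ρ j then I else if box ρ i j then V else O

  matrix-I : ∀ ρ {i j} → i ≡ to ρ j → matrix ρ (i , j) ≡ I
  matrix-I ρ {j = j} refl rewrite ≡⇒true {to ρ j} refl = refl

  matrix-V : ∀ ρ {i j} → i < to ρ j → j < from ρ i → matrix ρ (i , j) ≡ V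
  matrix-V ρ p q rewrite ≢⇒false (<⇒≢ p) | box⁺ ρ p q = refl

  matrix-O : ∀ ρ {i j} → i ≢ to ρ j → (i < to ρ j → ¬ j < from ρ i) → matrix ρ (i , j) ≡ O
  matrix-O ρ p q rewrite ≢⇒false p | box-false ρ q = refl

  matrix-V⁻ : ∀ ρ {i j} → matrix ρ (i , j) ≡ V → i < to ρ j × j < from ρ i
  matrix-V⁻ ρ {i} {j} v with i ≡ᵇ to ρ j | box ρ i j in eq
  ... | false | true = box⁻ ρ eq

  matrix-I⁻ : ∀ ρ {i j} → matrix ρ (i , j) ≡ I → i ≡ to ρ j
  matrix-I⁻ ρ {i} {j} v with i ≡ᵇ to ρ j in eq | box ρ i j
  ... | true | _ = true⇒≡ eq
  matrix-I⁻ ρ {i} {j} () | false | true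
  matrix-I⁻ ρ {i} {j} () | false | false

  rowWord : Perm n → (Edge → Bool) → ℕ → ℕ → List ℕ
  rowWord ρ S r zero = []
  rowWord ρ S r (suc m) = rowWord ρ S r m ++
    letterIf (box ρ r (suc m)) (S (r , suc m)) (r + cnt (box ρ r) m)

  -- The reading word of rows p + t - 1, …, p.
  rowsWord : Perm n → (Edge → Bool) → ℕ → ℕ → List ℕ
  rowsWord ρ S zero p = []
  rowsWord ρ S (suc t) p = rowsWord ρ S t (suc p) ++ rowWord ρ S p n

  rowWord-noBox : ∀ ρ S r m → box ρ r (suc m) ≡ false → rowWord ρ S r (suc m) ≡ rowWord ρ S r m
  rowWord-noBox ρ S r m eq rewrite eq = ++-identityʳ _

  -- Equivalent to the rows below `p` of the diagram being empty.
  FixedBelow : Perm n → ℕ → Set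
  FixedBelow ρ p = ∀ x → x < p → to ρ x ≡ x

  from≥ : ∀ ρ p → FixedBelow ρ p → p ≤ from ρ p
  from≥ ρ p fix with p ≤? from ρ p
  ... | yes q = q
  ... | no q = contradiction (≰⇒> q)
    (<-irrefl (trans (sym (fix _ (≰⇒> q))) (to-from ρ p)))

  swapPerm : (ρ : Perm n) (k : ℕ) → 1 ≤ k → k < n → Perm n
  swapPerm ρ k 1≤k k<n = record
    { to = to ρ ∘ sℕ k
    ; from = sℕ k ∘ from ρ
    ; from-to = λ x → trans (cong (sℕ k) (from-to ρ _)) (sℕ-involutive k x)
    ; to-from = λ x → trans (cong (to ρ) (sℕ-involutive k _)) (to-from ρ x)
    ; to-zero = trans (cong (to ρ) (sℕ-other (<⇒≢ 1≤k) (λ ()))) (to-zero ρ)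
    ; to-big = λ x n<x → trans (cong (to ρ) (sℕ-other (λ { refl → <-asym k<n n<x }) (λ { refl → <⇒≱ n<x k<n })))
                               (to-big ρ x n<x)
    }

  -- Row `p` is the lowest nonempty row and has its 1 in column `k + 1`, so `(p , k)` is its
  -- rightmost box and the last box in reading order.
  module Lowest (ρ : Perm n) (S : Edge → Bool) (p k : ℕ) (1≤p : 1 ≤ p) (p≤k : p ≤ k) (k<n : k < n)
    (fix : FixedBelow ρ p) (from-p : from ρ p ≡ suc k) where

    1≤k : 1 ≤ k
    1≤k = ≤-trans 1≤p p≤k

    ρ' : Perm n
    ρ' = swapPerm ρ k 1≤k k<n

    S' : Edge → Bool
    S' (r , c) = S (r , sℕ k c)

    to-k+1 : to ρ (suc k) ≡ p
    to-k+1 = trans (cong (to ρ) (sym from-p)) (to-from ρ p)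

    to>p : ∀ {c} → p ≤ c → c ≢ suc k → p < to ρ c
    to>p {c} p≤c c≢ with <-cmp p (to ρ c)
    ... | tri< lt _ _ = lt
    ... | tri≈ _ eq _ = contradiction (to-injective ρ (trans (sym eq) (sym to-k+1))) c≢
    ... | tri> _ _ gt = contradiction (subst (_< p) (to-injective ρ (fix _ gt)) gt) (≤⇒≯ p≤c)

    p<to-k : p < to ρ k
    p<to-k = to>p p≤k (1+n≢n ∘ sym)

    fixed-from : ∀ {x} → x < p → from ρ x ≡ x
    fixed-from lt = from-fixed ρ (fix _ lt)

    fix' : FixedBelow ρ' p
    fix' x lt = trans (cong (to ρ) (sℕ-other (<⇒≢ x<k) (<⇒≢ (m<n⇒m<1+n x<k)))) (fix x lt)
      where x<k = <-≤-trans lt p≤k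

    -- The order between `c` and the column of the 1 in row `r` is reversed only for the pair `k`,
    -- `k + 1`. This happens at the excluded box in row `p`, and in the row of the 1 of column `k`,
    -- which lies above `p` and so fails the other test.
    box-agree : ∀ r c → ¬ (r ≡ p × c ≡ suc k) → box ρ r (sℕ k c) ≡ box ρ' r c
    box-agree r c ne = Bool-ext f g
      where
      f : box ρ r (sℕ k c) ≡ true → box ρ' r c ≡ true
      f b with x , y ← box⁻ ρ b =
        box⁺ ρ' x (subst (_< sℕ k (from ρ r)) (sℕ-involutive k c)
          (sℕ-mono-< k y λ e e' → ne (from-injective ρ (trans e' (sym from-p)) , sℕ-right⁻ e)))
      g : box ρ' r c ≡ true → box ρ r (sℕ k c) ≡ true
      g b with x , y ← box⁻ ρ' b =
        box⁺ ρ x (subst (sℕ k c <_) (sℕ-involutive k _)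
          (sℕ-mono-< k y λ { refl e' → <-asym p<to-k
            (subst₂ _<_ (trans (sym (to-from ρ r)) (cong (to ρ) (sℕ-left⁻ e')))
              (trans (cong (to ρ) (sℕ-left k)) to-k+1) x) }))

    step : Step (matrix ρ') (matrix ρ) S' S p k
    step = record
      { 1≤p = 1≤p
      ; 1≤k = 1≤k
      ; agree = λ r c ne → cong (λ b → if r ≡ᵇ to ρ (sℕ k c) then I else if b then V else O) (box-agree r c ne)
      ; old = matrix-O ρ' (λ e → <-irrefl (trans e (cong (to ρ) (sℕ-right k))) p<to-k)
                λ _ lt → <⇒≱ (subst (suc k <_) (trans (cong (sℕ k) from-p) (sℕ-right k)) lt) (n≤1+n k)
      ; new = matrix-V ρ p<to-k (subst (k <_) (sym from-p) ≤-refl)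
      ; unit = matrix-I ρ' (sym (trans (cong (to ρ) (sℕ-left k)) to-k+1))
      ; only = only
      ; low = λ r r<p → matrix-O ρ
          (λ e → <⇒≢ (<-≤-trans r<p p≤k) (trans (sym (fixed-from r<p)) (trans (cong (from ρ) e) (from-to ρ k))))
          λ _ lt → <-asym (subst (k <_) (fixed-from r<p) lt) (<-≤-trans r<p p≤k)
      ; agreeS = λ _ _ → refl
      }
      where
      to'-k : to ρ' k ≡ p
      to'-k = trans (cong (to ρ) (sℕ-left k)) to-k+1
      only : ∀ r → matrix ρ' (r , k) ≢ O → r ≡ p
      only r nz with r ≟ p
      ... | yes eq = eq
      ... | no ne = contradiction (matrix-O ρ' (ne ∘ λ e → trans e to'-k) none) nz
        where
        none : r < to ρ' k → ¬ k < from ρ' r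
        none lt k< = <-asym r<k (subst (k <_) (from-fixed ρ' (fix' r r<p)) k<)
          where
          r<p = subst (r <_) to'-k lt
          r<k = <-≤-trans r<p p≤k

    cnt-agree : ∀ {r} m → p < r → m ≢ k → cnt (box ρ' r) m ≡ cnt (box ρ r) m
    cnt-agree {r} m p<r m≢k =
      trans (cnt-cong m λ c _ _ → sym (box-agree r c λ { (refl , _) → <-irrefl refl p<r }))
            (sumTo-swap (indicator ∘ box ρ r) m 1≤k m≢k)

    noBox : ∀ {r} → p < r → box ρ r (suc k) ≡ false
    noBox p<r = box-false ρ λ lt → contradiction (subst (_ <_) to-k+1 lt) (<-asym p<r)

    -- Above row `p`, column `k + 1` of `ρ` and column `k` of `ρ'` have no box. A box in column `k`
    -- therefore moves past an empty column and keeps its label. The prefix of length `k` would cut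
    -- between the two columns.
    rowWord-above : ∀ {r} m → p < r → m ≢ k → rowWord ρ' S' r m ≡ rowWord ρ S r m
    rowWord-above zero p<r m≢k = refl
    rowWord-above {r} (suc m) p<r m≢k = go (swapView k (suc m)) m≢k (m ≟ k)
      where
      box-eq : ∀ c → box ρ' r c ≡ box ρ r (sℕ k c)
      box-eq c = sym (box-agree r c λ { (refl , _) → <-irrefl refl p<r })
      go : SwapView k (suc m) → suc m ≢ k → Dec (m ≡ k) → rowWord ρ' S' r (suc m) ≡ rowWord ρ S r (suc m)
      go left m≢k _ = contradiction refl m≢k
      go right _ (no m≢) = contradiction refl m≢
      go (other a b) _ (yes refl) = contradiction refl b
      go (other a b) _ (no m≢) = cong₂ _++_ (rowWord-above m p<r m≢)
        (letterIf-cong (trans (box-eq (suc m)) (cong (box ρ r) (sℕ-other a b)))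
          (cong (λ c → S (r , c)) (sℕ-other a b)) (cong (r +_) (cnt-agree m p<r m≢)))
      go _ _ (yes refl) = at-k m refl 1≤k
        where
        at-k : ∀ m → m ≡ k → 1 ≤ m → rowWord ρ' S' r (suc m) ≡ rowWord ρ S r (suc m)
        at-k m@(suc m₀) refl _ = begin
          rowWord ρ' S' r (suc k)
            ≡⟨ cong₂ _++_ (trans (rowWord-noBox ρ' S' r m₀ box'-k) (rowWord-above m₀ p<r (1+n≢n ∘ sym))) last-eq ⟩
          rowWord ρ S r k
            ≡⟨ rowWord-noBox ρ S r k (noBox p<r) ⟨
          rowWord ρ S r (suc k) ∎
          where
          open ≡-Reasoning
          box'-k : box ρ' r k ≡ false
          box'-k = trans (box-eq k) (trans (cong (box ρ r) (sℕ-left k)) (noBox p<r))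
          last-eq : letterIf (box ρ' r (suc k)) (S' (r , suc k)) (r + cnt (box ρ' r) k)
            ≡ letterIf (box ρ r k) (S (r , k)) (r + cnt (box ρ r) m₀)
          last-eq = letterIf-cong
            (trans (box-eq (suc k)) (cong (box ρ r) (sℕ-right k)))
            (cong (λ c → S (r , c)) (sℕ-right k))
            (cong (r +_) (trans (cong₂ _+_ (cnt-agree m₀ p<r (1+n≢n ∘ sym)) (cong indicator box'-k)) (+-identityʳ _)))

    rowsWord-above : ∀ t r → p < r → rowsWord ρ' S' t r ≡ rowsWord ρ S t r
    rowsWord-above zero r p<r = refl
    rowsWord-above (suc t) r p<r =
      cong₂ _++_ (rowsWord-above t (suc r) (m<n⇒m<1+n p<r)) (rowWord-above n p<r (<⇒≢ k<n ∘ sym))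

    box-p-left : ∀ {c} → c < p → box ρ p c ≡ false
    box-p-left {c} c<p = box-false ρ λ lt → contradiction (subst (p <_) (fix c c<p) lt) (<-asym c<p)

    box-p : ∀ {c} → p ≤ c → c ≤ k → box ρ p c ≡ true
    box-p p≤c c≤k = box⁺ ρ (to>p p≤c (<⇒≢ (s≤s c≤k))) (subst (_ <_) (sym from-p) (s≤s c≤k))

    box-p-right : ∀ {c} → suc k ≤ c → box ρ p c ≡ false
    box-p-right k<c = box-false ρ λ _ lt → <⇒≱ (subst (_ <_) from-p lt) k<c

    from'-p : from ρ' p ≡ k
    from'-p = trans (cong (sℕ k) from-p) (sℕ-right k)

    box'-p-right : ∀ {c} → k ≤ c → box ρ' p c ≡ false
    box'-p-right k≤c = box-false ρ' λ _ lt → <⇒≱ (subst (_ <_) from'-p lt) k≤c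

    -- The boxes of row `p` fill exactly the columns from `p` to `k`. Hence the label of `(p , k)`
    -- is `p + (k - p) = k`: the last letter has the same index as the column exchange.
    cnt-p : ∀ m → m ≤ k → cnt (box ρ p) m ≡ suc m ∸ p
    cnt-p zero _ = sym (m≤n⇒m∸n≡0 1≤p)
    cnt-p (suc m) m<k with p ≤? suc m
    ... | yes p≤m rewrite box-p p≤m m<k | cnt-p m (<⇒≤ m<k) =
      trans (+-comm (suc m ∸ p) 1) (sym (+-∸-assoc 1 p≤m))
    ... | no p≰m rewrite box-p-left (≰⇒> p≰m) | cnt-p m (<⇒≤ m<k)
                       | m≤n⇒m∸n≡0 (<⇒≤ (≰⇒> p≰m)) | m≤n⇒m∸n≡0 (≰⇒> p≰m) = refl

    rowWord-p-left : ∀ m → m < k → rowWord ρ' S' p m ≡ rowWord ρ S p m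
    rowWord-p-left zero _ = refl
    rowWord-p-left (suc m) m<k = cong₂ _++_ (rowWord-p-left m (<-trans ≤-refl m<k))
      (letterIf-cong (box'-p m<k) (cong (λ c → S (p , c)) (s-fix m<k))
        (cong (p +_) (cnt-cong m λ c _ c≤m → box'-p (<-trans (s≤s c≤m) m<k))))
      where
      s-fix : ∀ {c} → c < k → sℕ k c ≡ c
      s-fix c<k = sℕ-other (<⇒≢ c<k) (<⇒≢ (m<n⇒m<1+n c<k))
      box'-p : ∀ {c} → c < k → box ρ' p c ≡ box ρ p c
      box'-p {c} c<k = trans (sym (box-agree p c (<⇒≢ (m<n⇒m<1+n c<k) ∘ proj₂))) (cong (box ρ p) (s-fix c<k))

    letter : List ℕ
    letter = if S (p , k) then [] else k ∷ []

    rowWord-p : ∀ m → k ≤ m → rowWord ρ S p m ≡ rowWord ρ' S' p m ++ letter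
    rowWord-p m k≤m with m≤n⇒∃[o]m+o≡n k≤m
    ... | o , refl = go o
      where
      at-k : ∀ l → l ≡ k → rowWord ρ S p l ≡ rowWord ρ' S' p l ++ letter
      at-k zero refl with () ← 1≤k
      at-k (suc l) refl = begin
        rowWord ρ S p l ++ _
          ≡⟨ cong₂ _++_ (sym (rowWord-p-left l ≤-refl)) last-eq ⟩
        rowWord ρ' S' p l ++ letter
          ≡⟨ cong (_++ letter) (rowWord-noBox ρ' S' p l (box'-p-right ≤-refl)) ⟨
        rowWord ρ' S' p (suc l) ++ letter ∎
        where
        open ≡-Reasoning
        keep-or-drop : ∀ s → letterIf true s k ≡ (if s then [] else k ∷ [])
        keep-or-drop true = refl
        keep-or-drop false = refl
        last-eq : letterIf (box ρ p k) (S (p , k)) (p + cnt (box ρ p) l) ≡ letter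
        last-eq = trans
          (letterIf-cong (box-p p≤k ≤-refl) refl (trans (cong (p +_) (cnt-p l (n≤1+n l))) (m+[n∸m]≡n p≤k)))
          (keep-or-drop (S (p , k)))
      go : ∀ o → rowWord ρ S p (k + o) ≡ rowWord ρ' S' p (k + o) ++ letter
      go zero = at-k (k + 0) (+-identityʳ k)
      go (suc o) rewrite +-suc k o
        | rowWord-noBox ρ S p (k + o) (box-p-right (s≤s (m≤m+n k o)))
        | rowWord-noBox ρ' S' p (k + o) (box'-p-right (m≤n⇒m≤1+n (m≤m+n k o))) = go o

    rowsWord-p : ∀ t → rowsWord ρ S (suc t) p ≡ rowsWord ρ' S' (suc t) p ++ letter
    rowsWord-p t = trans
      (cong₂ _++_ (sym (rowsWord-above t (suc p) ≤-refl)) (rowWord-p n (<⇒≤ k<n)))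
      (sym (++-assoc (rowsWord ρ' S' t (suc p)) _ _))

  -- Induction on the boxes of the diagram.

  ValidLetter : ℕ → Set
  ValidLetter a = 1 ≤ a × a < n

  record Claim (Z : Pattern) (S : Edge → Bool) (W : List ℕ) : Set where
    field
      valid : All ValidLetter W
      found : ∀ i j r → r ≤ R (demazure n W) i j → ∃ (Good Z S i j r)

  diagonal : ℕ → List Edge
  diagonal zero = []
  diagonal (suc r) = (suc r , suc r) ∷ diagonal r

  rows-diagonal : ∀ r → rowsOf (diagonal r) ≡ applyDownFrom suc r
  rows-diagonal zero = refl
  rows-diagonal (suc r) = cong (suc r ∷_) (rows-diagonal r)

  cols-diagonal : ∀ r → colsOf (diagonal r) ≡ applyDownFrom suc r
  cols-diagonal zero = refl
  cols-diagonal (suc r) = cong (suc r ∷_) (cols-diagonal r)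

  length-diagonal : ∀ r → length (diagonal r) ≡ r
  length-diagonal zero = refl
  length-diagonal (suc r) = cong suc (length-diagonal r)

  R-≤ : ∀ u i j → R u i j ≤ j
  R-≤ u i zero = z≤n
  R-≤ u i (suc j) = ≤-trans (R-≤-suc u i j) (s≤s (R-≤ u i j))

  R-id-≤ : ∀ i j → R id i j ≤ i
  R-id-≤ i zero = z≤n
  R-id-≤ i (suc j) with suc j ≤? i
  ... | yes p = ≤-trans (R-≤ id i (suc j)) p
  ... | no p = subst (_≤ i) (sym (R-no id i j p)) (R-id-≤ i j)

  -- The diagram is empty, so there is no variable and maximality is vacuous; the ones on the
  -- diagonal provide every size up to both bounds.
  claim-identity : ∀ ρ S → (∀ x → to ρ x ≡ x) → Claim (matrix ρ) S []
  claim-identity ρ S fix = record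
    { valid = []
    ; found = λ i j r r≤ → diagonal r , record
      { isMaximal = record
        { unique-rows = subst Unique (sym (rows-diagonal r)) uniq
        ; unique-cols = subst Unique (sym (cols-diagonal r)) uniq
        ; supported = All.map (λ { {a , b} refl o → I≢O (trans (sym (matrix-I ρ {a} {a} (sym (fix a)))) o) }) (diag r)
        ; maximal = λ { _ _ _ _ (beats e v _ _ _) → noVar e v }
        }
      ; size = length-diagonal r
      ; within = go i j r (≤-trans r≤ (R-id-≤ i j)) (≤-trans r≤ (R-≤ id i j))
      ; chosen = All.tabulate λ {e} _ v → ⊥-elim (noVar e v)
      }
    }
    where
    uniq : ∀ {r} → Unique (applyDownFrom suc r)
    uniq {r} = Unique.applyDownFrom⁺₁ suc r λ j<i _ eq → <⇒≢ j<i (sym (suc-injective eq))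
    noVar : ∀ e → matrix ρ e ≡ V → ⊥
    noVar (a , b) v with x , y ← matrix-V⁻ ρ v =
      <-asym (subst (a <_) (fix b) x) (subst (b <_) (from-fixed ρ (fix a)) y)
    diag : ∀ r → All (λ e → proj₁ e ≡ proj₂ e) (diagonal r)
    diag zero = []
    diag (suc r) = refl ∷ diag r
    go : ∀ i j r → r ≤ i → r ≤ j → All (Inside i j) (diagonal r)
    go i j zero _ _ = []
    go i j (suc r) a b = inside (s≤s z≤n) a (s≤s z≤n) b ∷ go i j r (<⇒≤ a) (<⇒≤ b)

  claim-step : ∀ {Z' Z S' S p k W} → Step Z' Z S' S p k → k < n → Claim Z' S' W →
    Claim Z S (W ++ (if S (p , k) then [] else k ∷ []))
  claim-step {Z'} {Z} {S'} {S} {p} {k@(suc k₀)} {W} st k<n C with S (p , k) in eq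
  ... | true rewrite ++-identityʳ W = record
    { valid = Claim.valid C
    ; found = λ i j r r≤ → add i j r (Claim.found C i j r r≤)
    }
    where
    add : ∀ i j r → ∃ (Good Z' S' i j r) → ∃ (Good Z S i j r)
    add i j r (_ , G) with j ≟ k
    ... | yes refl = step-in st eq G
    ... | no j≢k = step-other st j≢k G
  ... | false = record
    { valid = All.++⁺ (Claim.valid C) ((s≤s z≤n , k<n) ∷ [])
    ; found = found
    }
    where
    found : ∀ i j r → r ≤ R (demazure n (W ∷ʳ k)) i j → ∃ (Good Z S i j r)
    found i j r r≤ with j ≟ k
    ... | no j≢k = step-other st j≢k (proj₂ (Claim.found C i j r (subst (r ≤_) (R-demazure n W i (s≤s z≤n) j≢k) r≤)))
    ... | yes refl with R-demazure-at n W i r k<n r≤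
    ...   | inj₂ r< = step-out st (proj₂ (Claim.found C i (suc k) (suc r) r<))
    -- The column bound `k - 1` differs from `k`, so the step applies there, and the bound is
    -- relaxed to `k` afterwards.
    ...   | inj₁ r≤' with _ , G ← step-other st {j = k₀} (1+n≢n ∘ sym) (proj₂ (Claim.found C i k₀ r r≤')) =
      _ , Good-widen (All.map (m≤n⇒m≤1+n ∘ col≤) (Good.within G)) G
  claim-step {k = zero} st _ _ with () ← Step.1≤k st

  -- `t` counts the rows from `p` to `n` and `d` the boxes of row `p`; the recursion descends
  -- lexicographically in the pair. An empty row moves `p` up by one, a nonempty one loses its last
  -- box.
  claim : ∀ t p d ρ S → p + t ≡ suc n → 1 ≤ p → FixedBelow ρ p → from ρ p ≡ p + d →
    Claim (matrix ρ) S (rowsWord ρ S t p)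
  claim zero p d ρ S p≡ 1≤p fix _ = claim-identity ρ S all
    where
    all : ∀ x → to ρ x ≡ x
    all x with x ≤? n
    ... | yes x≤n = fix x (subst (x <_) (sym (trans (sym (+-identityʳ p)) p≡)) (s≤s x≤n))
    ... | no x≰n = to-big ρ x (≰⇒> x≰n)
  claim (suc t) p zero ρ S p≡ 1≤p fix from-p =
    subst (Claim (matrix ρ) S) (sym (trans (cong (rowsWord ρ S t (suc p) ++_) (empty n)) (++-identityʳ _)))
      (claim t (suc p) (from ρ (suc p) ∸ suc p) ρ S (trans (sym (+-suc p t)) p≡) (s≤s z≤n) fix'
        (sym (m+[n∸m]≡n (from≥ ρ (suc p) fix'))))
    where
    from-p≡p : from ρ p ≡ p
    from-p≡p = trans from-p (+-identityʳ p)
    fix' : FixedBelow ρ (suc p)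
    fix' x x<1+p with x ≟ p
    ... | yes refl = trans (cong (to ρ) (sym from-p≡p)) (to-from ρ x)
    ... | no x≢p = fix x (≤∧≢⇒< (≤-pred x<1+p) x≢p)
    empty : ∀ m → rowWord ρ S p m ≡ []
    empty zero = refl
    empty (suc m) = trans (rowWord-noBox ρ S p m (box-false ρ λ p< lt →
      let c<p = subst (suc m <_) from-p≡p lt in <-asym c<p (subst (p <_) (fix (suc m) c<p) p<))) (empty m)
  claim (suc t) p (suc d) ρ S p≡ 1≤p fix from-p =
    subst (Claim (matrix ρ) S) (sym (rowsWord-p t))
      (claim-step step k<n (claim (suc t) p d ρ' S' p≡ 1≤p fix' from'-p))
    where
    p≤n : p ≤ n
    p≤n = ≤-pred (subst (p <_) p≡ (m<m+n p (s≤s z≤n)))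
    k<n : p + d < n
    k<n = subst (_≤ n) (trans from-p (+-suc p d)) (from-≤ ρ p≤n)
    open Lowest ρ S p (p + d) 1≤p (m≤m+n p d) k<n fix (trans from-p (+-suc p d))

-- Coefficients

module _ {n : ℕ} where

  _≐_ : Monomial n → Monomial n → Set
  m ≐ m' = ∀ r c → m r c ≡ m' r c

  _∙_ : Monomial n → Monomial n → Monomial n
  (m ∙ m') r c = m r c + m' r c

  coeff-yes : ∀ a {m' m : Monomial n} p → m' ≐ m → coeff ((a , m') ∷ p) m ≡ a ℤ.+ coeff p m
  coeff-yes a {m'} {m} p eq rewrite dec-true (m' ≟ₘ m) eq = refl

  coeff-no : ∀ a {m' m : Monomial n} p → ¬ m' ≐ m → coeff ((a , m') ∷ p) m ≡ coeff p m
  coeff-no a {m'} {m} p ne rewrite dec-false (m' ≟ₘ m) ne = refl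

  coeff-+P : ∀ (p q : Poly n) m → coeff (p +P q) m ≡ coeff p m ℤ.+ coeff q m
  coeff-+P [] q m = sym (ℤ.+-identityˡ _)
  coeff-+P ((a , m') ∷ p) q m with m' ≟ₘ m
  ... | yes e = begin
    coeff ((a , m') ∷ p +P q) m           ≡⟨ coeff-yes a (p +P q) e ⟩
    a ℤ.+ coeff (p +P q) m                ≡⟨ cong (λ x → a ℤ.+ x) (coeff-+P p q m) ⟩
    a ℤ.+ (coeff p m ℤ.+ coeff q m)       ≡⟨ ℤ.+-assoc a _ _ ⟨
    (a ℤ.+ coeff p m) ℤ.+ coeff q m       ≡⟨ cong (λ x → x ℤ.+ coeff q m) (coeff-yes a p e) ⟨
    coeff ((a , m') ∷ p) m ℤ.+ coeff q m  ∎
    where open ≡-Reasoning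
  ... | no ne = trans (coeff-no a (p +P q) ne)
                  (trans (coeff-+P p q m) (cong (λ x → x ℤ.+ coeff q m) (sym (coeff-no a p ne))))

  coeff-negP : ∀ (p : Poly n) m → coeff (negP p) m ≡ ℤ.- coeff p m
  coeff-negP [] m = refl
  coeff-negP ((a , m') ∷ p) m with m' ≟ₘ m
  ... | yes e = begin
    coeff ((ℤ.- a , m') ∷ negP p) m  ≡⟨ coeff-yes (ℤ.- a) (negP p) e ⟩
    ℤ.- a ℤ.+ coeff (negP p) m       ≡⟨ cong (λ x → ℤ.- a ℤ.+ x) (coeff-negP p m) ⟩
    ℤ.- a ℤ.+ ℤ.- coeff p m          ≡⟨ ℤ.neg-distrib-+ a _ ⟨
    ℤ.- (a ℤ.+ coeff p m)            ≡⟨ cong ℤ.-_ (coeff-yes a p e) ⟨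
    ℤ.- coeff ((a , m') ∷ p) m       ∎
    where open ≡-Reasoning
  ... | no ne = trans (coeff-no (ℤ.- a) (negP p) ne)
                  (trans (coeff-negP p m) (cong ℤ.-_ (sym (coeff-no a p ne))))

  signed : ℕ → Poly n → Poly n
  signed i p = if evenᵇ i then p else negP p

  coeff-signed-0 : ∀ i p m → coeff p m ≡ ℤ.0ℤ → coeff (signed i p) m ≡ ℤ.0ℤ
  coeff-signed-0 i p m eq with evenᵇ i
  ... | true = eq
  ... | false = trans (coeff-negP p m) (cong ℤ.-_ eq)

  coeff-signed-0⁻ : ∀ i p m → coeff (signed i p) m ≡ ℤ.0ℤ → coeff p m ≡ ℤ.0ℤ
  coeff-signed-0⁻ i p m eq with evenᵇ i
  ... | true = eq
  ... | false = ℤ.neg-injective (trans (sym (coeff-negP p m)) eq)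

  coeff-mono-* : ∀ (μ : Monomial n) q {m m'} → m ≐ (μ ∙ m') →
    coeff (((ℤ.1ℤ , μ) ∷ []) *P q) m ≡ coeff q m'
  coeff-mono-* μ [] eq = refl
  coeff-mono-* μ ((b , m'') ∷ q) {m} {m'} eq with m'' ≟ₘ m'
  ... | yes e = trans (coeff-yes (ℤ.1ℤ ℤ.* b) (((ℤ.1ℤ , μ) ∷ []) *P q) (λ r c → trans (cong (μ r c +_) (e r c)) (sym (eq r c))))
                      (trans (cong₂ ℤ._+_ (ℤ.*-identityˡ b) (coeff-mono-* μ q eq)) (sym (coeff-yes b q e)))
  ... | no ne = trans (coeff-no (ℤ.1ℤ ℤ.* b) (((ℤ.1ℤ , μ) ∷ []) *P q) (λ e → ne λ r c → +-cancelˡ-≡ (μ r c) _ _ (trans (e r c) (eq r c))))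
                      (trans (coeff-mono-* μ q eq) (sym (coeff-no b q ne)))

  coeff-mono-*-∤ : ∀ (μ : Monomial n) q {m} → ¬ (μ ∣ₘ m) → coeff (((ℤ.1ℤ , μ) ∷ []) *P q) m ≡ ℤ.0ℤ
  coeff-mono-*-∤ μ [] nd = refl
  coeff-mono-*-∤ μ ((b , m'') ∷ q) nd =
    trans (coeff-no (ℤ.1ℤ ℤ.* b) (((ℤ.1ℤ , μ) ∷ []) *P q) (λ e → nd λ r c → subst (μ r c ≤_) (e r c) (m≤m+n _ _)))
          (coeff-mono-*-∤ μ q nd)

  _∣ₘ?_ : ∀ (μ m : Monomial n) → Dec (μ ∣ₘ m)
  μ ∣ₘ? m = all? λ r → all? λ c → μ r c ≤? m r c

  coeff-mono-*-≢0 : ∀ (μ : Monomial n) q {m} → coeff (((ℤ.1ℤ , μ) ∷ []) *P q) m ≢ ℤ.0ℤ →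
    Σ (Monomial n) λ m' → m ≐ (μ ∙ m') × coeff q m' ≢ ℤ.0ℤ
  coeff-mono-*-≢0 μ q {m} nz with μ ∣ₘ? m
  ... | no nd = contradiction (coeff-mono-*-∤ μ q nd) nz
  ... | yes d = m' , eq , nz ∘ trans (coeff-mono-* μ q eq)
    where
    m' : Monomial n
    m' r c = m r c ∸ μ r c
    eq : m ≐ (μ ∙ m')
    eq r c = sym (m+[n∸m]≡n (d r c))

  coeff-sumP-≢0 : ∀ {A : Set} (f : A → Poly n) xs {m} → coeff (sumP (map f xs)) m ≢ ℤ.0ℤ →
    Σ A λ x → coeff (f x) m ≢ ℤ.0ℤ
  coeff-sumP-≢0 f [] nz = contradiction refl nz
  coeff-sumP-≢0 f (x ∷ xs) {m} nz with coeff (f x) m ℤ.≟ ℤ.0ℤ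
  ... | no ne = x , ne
  ... | yes eq = coeff-sumP-≢0 f xs λ e → nz (trans (coeff-+P (f x) _ m) (cong₂ ℤ._+_ eq e))

  coeff-sumP-0 : ∀ {A : Set} (f : A → Poly n) xs {m} → (∀ {x} → x ∈ xs → coeff (f x) m ≡ ℤ.0ℤ) →
    coeff (sumP (map f xs)) m ≡ ℤ.0ℤ
  coeff-sumP-0 f [] z = refl
  coeff-sumP-0 f (x ∷ xs) {m} z =
    trans (coeff-+P (f x) _ m) (cong₂ ℤ._+_ (z (here refl)) (coeff-sumP-0 f xs (z ∘ there)))

  coeff-sumP-single : ∀ {A : Set} (f : A → Poly n) xs {m x} → Unique xs → x ∈ xs →
    (∀ y → y ≢ x → coeff (f y) m ≡ ℤ.0ℤ) → coeff (sumP (map f xs)) m ≡ coeff (f x) m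
  coeff-sumP-single f (x ∷ xs) {m} u (here refl) z =
    trans (coeff-+P (f x) _ m)
      (trans (cong (λ y → coeff (f x) m ℤ.+ y) (coeff-sumP-0 f xs λ { y∈ → z _ λ { refl → Unique-∷⇒∉ u y∈ } }))
             (ℤ.+-identityʳ _))
  coeff-sumP-single f (y ∷ xs) {m} (y≢ ∷ u) (there x∈) z =
    trans (coeff-+P (f y) _ m)
      (trans (cong₂ ℤ._+_ (z y λ { refl → All.lookup y≢ x∈ refl }) (coeff-sumP-single f xs u x∈ z))
             (ℤ.+-identityˡ _))

-- Bijections from the rows to the columns of a minor, encoded along the Laplace recursion of det.
data Code : ℕ → Set where
  []  : Code 0
  _∷_ : ∀ {k} → Fin (suc k) → Code k → Code (suc k)

InjectiveFin : ∀ {k n} → (Fin k → Fin n) → Set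
InjectiveFin f = ∀ {a b} → f a ≡ f b → a ≡ b

-- Leading monomials of minors.

module Minors {n : ℕ} (Z : Pattern) (E : Fin n → Fin n → Poly n) where

  entryPoly : Entry → Fin n → Fin n → Poly n
  entryPoly O r c = 0P
  entryPoly I r c = 1P
  entryPoly V r c = varP r c

  entryWeight : Entry → Fin n → Fin n → Monomial n
  entryWeight V r c = varM r c
  entryWeight _ r c = unitM

  varM-self : ∀ (r c : Fin n) → varM r c r c ≡ 1
  varM-self r c with r Data.Fin.≟ r | c Data.Fin.≟ c
  ... | yes _ | yes _ = refl
  ... | yes _ | no ne = contradiction refl ne
  ... | no ne | _ = contradiction refl ne

  varM≤1 : ∀ (r c r' c' : Fin n) → varM r c r' c' ≤ 1
  varM≤1 r c r' c' with does (r Data.Fin.≟ r') ∧ does (c Data.Fin.≟ c')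
  ... | true = ≤-refl
  ... | false = z≤n

  varM-≥1 : ∀ (r c r' c' : Fin n) → 1 ≤ varM r c r' c' → r ≡ r' × c ≡ c'
  varM-≥1 r c r' c' lt with r Data.Fin.≟ r' | c Data.Fin.≟ c'
  ... | yes p | yes q = p , q

  entryWeight-≤1 : ∀ z r c r' c' → entryWeight z r c r' c' ≤ 1
  entryWeight-≤1 O r c r' c' = z≤n
  entryWeight-≤1 I r c r' c' = z≤n
  entryWeight-≤1 V r c r' c' = varM≤1 r c r' c'

  entryWeight-≥1 : ∀ z {r c r' c'} → 1 ≤ entryWeight z r c r' c' → z ≡ V × r ≡ r' × c ≡ c'
  entryWeight-≥1 V lt = refl , varM-≥1 _ _ _ _ lt

  at : Fin n → Fin n → Edge
  at r c = pos r , pos c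

  edges : ∀ {k} → (Fin k → Fin n) → (Fin k → Fin n) → Code k → List Edge
  edges rows cols [] = []
  edges rows cols (c ∷ s) = at (rows fzero) (cols c) ∷ edges (rows ∘ fsuc) (cols ∘ punchIn c) s

  weight : ∀ {k} → (Fin k → Fin n) → (Fin k → Fin n) → Code k → Monomial n
  weight rows cols [] = unitM
  weight rows cols (c ∷ s) =
    entryWeight (Z (at (rows fzero) (cols c))) (rows fzero) (cols c) ∙ weight (rows ∘ fsuc) (cols ∘ punchIn c) s

  weight-≥1⁻ : ∀ {k} rows cols (s : Code k) {r c} → 1 ≤ weight rows cols s r c →
    at r c ∈ edges rows cols s × Z (at r c) ≡ V
  weight-≥1⁻ rows cols (c₀ ∷ s) {r} {c} lt
    with entryWeight (Z (at (rows fzero) (cols c₀))) (rows fzero) (cols c₀) r c in eq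
  ... | zero with x , y ← weight-≥1⁻ (rows ∘ fsuc) (cols ∘ punchIn c₀) s lt = there x , y
  ... | suc _ with v , refl , refl ← entryWeight-≥1 (Z (at (rows fzero) (cols c₀))) (subst (1 ≤_) (sym eq) (s≤s z≤n)) =
    here refl , v

  pos-injective : ∀ {a b : Fin n} → pos a ≡ pos b → a ≡ b
  pos-injective = toℕ-injective ∘ suc-injective

  weight-≥1 : ∀ {k} rows cols (s : Code k) {r c} → at r c ∈ edges rows cols s → Z (at r c) ≡ V →
    1 ≤ weight rows cols s r c
  weight-≥1 rows cols (c₀ ∷ s) (here eq) v
    with refl ← pos-injective (cong proj₁ eq) | refl ← pos-injective (cong proj₂ eq)
    rewrite v | varM-self (rows fzero) (cols c₀) = s≤s z≤n
  weight-≥1 rows cols (c₀ ∷ s) (there x) v = ≤-trans (weight-≥1 (rows ∘ fsuc) (cols ∘ punchIn c₀) s x v) (m≤n+m _ _)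

  weight-otherRow : ∀ {k} rows cols (s : Code k) {r} → (∀ a → rows a ≢ r) → ∀ c → weight rows cols s r c ≡ 0
  weight-otherRow rows cols [] ne c = refl
  weight-otherRow rows cols (c₀ ∷ s) {r} ne c
    with entryWeight (Z (at (rows fzero) (cols c₀))) (rows fzero) (cols c₀) r c in eq
  ... | zero = weight-otherRow (rows ∘ fsuc) (cols ∘ punchIn c₀) s (ne ∘ fsuc) c
  ... | suc _ with _ , e , _ ← entryWeight-≥1 (Z (at (rows fzero) (cols c₀))) (subst (1 ≤_) (sym eq) (s≤s z≤n)) =
    contradiction e (ne fzero)

  injective-suc : ∀ {k} {rows : Fin (suc k) → Fin n} → InjectiveFin rows → InjectiveFin (rows ∘ fsuc)
  injective-suc inj eq with refl ← inj eq = refl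

  injective-punchIn : ∀ {k} {cols : Fin (suc k) → Fin n} c → InjectiveFin cols → InjectiveFin (cols ∘ punchIn c)
  injective-punchIn c inj eq = punchIn-injective c _ _ (inj eq)

  first≢ : ∀ {k} {rows : Fin (suc k) → Fin n} → InjectiveFin rows → ∀ a → rows (fsuc a) ≢ rows fzero
  first≢ inj a eq with () ← inj eq

  -- Distinct rows contribute distinct variables. This squarefreeness lets membership of an edge
  -- stand for its exponent.
  weight-≤1 : ∀ {k} rows cols (s : Code k) → InjectiveFin rows → ∀ r c → weight rows cols s r c ≤ 1
  weight-≤1 rows cols [] inj r c = z≤n
  weight-≤1 rows cols (c₀ ∷ s) inj r c with rows fzero Data.Fin.≟ r
  ... | yes refl rewrite weight-otherRow (rows ∘ fsuc) (cols ∘ punchIn c₀) s (first≢ inj) c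
                       | +-identityʳ (entryWeight (Z (at (rows fzero) (cols c₀))) (rows fzero) (cols c₀) (rows fzero) c) =
    entryWeight-≤1 (Z (at (rows fzero) (cols c₀))) _ _ _ _
  ... | no ne with entryWeight (Z (at (rows fzero) (cols c₀))) (rows fzero) (cols c₀) r c in eq
  ...   | zero = weight-≤1 (rows ∘ fsuc) (cols ∘ punchIn c₀) s (injective-suc inj) r c
  ...   | suc _ = contradiction
    (proj₁ (proj₂ (entryWeight-≥1 (Z (at (rows fzero) (cols c₀))) (subst (1 ≤_) (sym eq) (s≤s z≤n))))) ne

  rows-edges : ∀ {k} rows cols (s : Code k) → rowsOf (edges rows cols s) ≡ tabulate (pos ∘ rows)
  rows-edges rows cols [] = refl
  rows-edges rows cols (c ∷ s) = cong (_ ∷_) (rows-edges _ _ s)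

  tabulate-punchIn : ∀ {A : Set} {k} (f : Fin (suc k) → A) c → tabulate f ↭ f c ∷ tabulate (f ∘ punchIn c)
  tabulate-punchIn f fzero = ↭-refl
  tabulate-punchIn {k = suc k} f (fsuc c) =
    ↭-trans (prep _ (tabulate-punchIn (f ∘ fsuc) c)) (swap _ _ ↭-refl)

  cols-edges : ∀ {k} rows cols (s : Code k) → colsOf (edges rows cols s) ↭ tabulate (pos ∘ cols)
  cols-edges rows cols [] = ↭-refl
  cols-edges rows cols (c ∷ s) =
    ↭-trans (prep _ (cols-edges _ _ s)) (↭-sym (tabulate-punchIn (pos ∘ cols) c))

  -- Matchings are built as unordered lists, while `det` expands row by row in a fixed order; the
  -- list is rearranged into that order.
  encode : ∀ {k} rows cols (σ : List Edge) → rowsOf σ ↭ tabulate (pos ∘ rows) → colsOf σ ↭ tabulate (pos ∘ cols) →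
    Σ (Code k) λ s → σ ↭ edges rows cols s
  encode {zero} rows cols [] _ _ = [] , ↭-refl
  encode {zero} rows cols (_ ∷ _) pr _ with () ← ↭-length pr
  encode {suc k} rows cols σ pr pc
    with (_ , y) , e∈ , refl ← ∈-map⁻ proj₁ (∈-resp-↭ (↭-sym pr) (here refl))
    with c , refl ← ∈-tabulate⁻ {f = pos ∘ cols} (∈-resp-↭ pc (∈-map⁺ proj₂ e∈))
    with σ₁ , σ↭ ← ∈⇒↭∷ e∈
    with s , σ₁↭ ← encode (rows ∘ fsuc) (cols ∘ punchIn c) σ₁
           (drop-∷ (↭-trans (↭-map⁺ proj₁ (↭-sym σ↭)) pr))
           (drop-∷ (↭-trans (↭-map⁺ proj₂ (↭-sym σ↭)) (↭-trans pc (tabulate-punchIn (pos ∘ cols) c))))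
    = c ∷ s , ↭-trans σ↭ (prep _ σ₁↭)

  module _ (E≡ : ∀ r c → E r c ≡ entryPoly (Z (at r c)) r c)
           (I-unique : ∀ {i j j'} → Z (i , j) ≡ I → Z (i , j') ≡ I → j ≡ j') where

    minor : ∀ {k} → (Fin k → Fin n) → (Fin k → Fin n) → Poly n
    minor rows cols = det _ λ a b → E (rows a) (cols b)

    laplaceTerm : ∀ {k} → (Fin (suc k) → Fin n) → (Fin (suc k) → Fin n) → Fin (suc k) → Poly n
    laplaceTerm rows cols c = E (rows fzero) (cols c) *P minor (rows ∘ fsuc) (cols ∘ punchIn c)

    E-mono : ∀ {r c} → Z (at r c) ≢ O → E r c ≡ (ℤ.1ℤ , entryWeight (Z (at r c)) r c) ∷ []
    E-mono {r} {c} nz rewrite E≡ r c with Z (at r c)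
    ... | O = contradiction refl nz
    ... | I = refl
    ... | V = refl

    E-zero : ∀ {r c} → Z (at r c) ≡ O → E r c ≡ []
    E-zero {r} {c} z rewrite E≡ r c | z = refl

    isO? : ∀ (z : Entry) → Dec (z ≡ O)
    isO? O = yes refl
    isO? I = no λ ()
    isO? V = no λ ()

    coeff-minor-≢0 : ∀ {k} rows cols {m} → coeff (minor {k} rows cols) m ≢ ℤ.0ℤ →
      Σ (Code k) λ s → Supported Z (edges rows cols s) × weight rows cols s ≐ m
    coeff-term-≢0 : ∀ {k} rows cols c {m} → coeff (laplaceTerm {k} rows cols c) m ≢ ℤ.0ℤ →
      Σ (Code k) λ s → Supported Z (edges rows cols (c ∷ s)) × weight rows cols (c ∷ s) ≐ m

    coeff-minor-≢0 {zero} rows cols {m} nz with unitM ≟ₘ m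
    ... | yes eq = [] , [] , eq
    ... | no ne = contradiction (coeff-no ℤ.1ℤ [] ne) nz
    coeff-minor-≢0 {suc k} rows cols {m} nz
      with c , nz₁ ← coeff-sumP-≢0 (λ c → signed (toℕ c) (laplaceTerm rows cols c)) (allFin (suc k)) {m} nz
      with s , sup , eq ← coeff-term-≢0 rows cols c {m} (nz₁ ∘ coeff-signed-0 (toℕ c) (laplaceTerm rows cols c) m)
      = c ∷ s , sup , eq

    coeff-term-≢0 rows cols c {m} nz with isO? (Z (at (rows fzero) (cols c)))
    ... | yes z = contradiction (cong (λ e → coeff (e *P minor (rows ∘ fsuc) (cols ∘ punchIn c)) m) (E-zero z)) nz
    ... | no ne
      with m' , eq , nz' ← coeff-mono-*-≢0 (entryWeight (Z (at (rows fzero) (cols c))) (rows fzero) (cols c))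
                             (minor (rows ∘ fsuc) (cols ∘ punchIn c)) {m}
                             (nz ∘ trans (cong (λ e → coeff (e *P minor (rows ∘ fsuc) (cols ∘ punchIn c)) m) (E-mono ne)))
      with s , sup , eq' ← coeff-minor-≢0 (rows ∘ fsuc) (cols ∘ punchIn c) nz'
      = s , ne ∷ sup , λ r c' → trans (cong (entryWeight (Z (at (rows fzero) (cols c))) (rows fzero) (cols c) r c' +_) (eq' r c'))
                                      (sym (eq r c'))

    -- No cancellation: the variables of a supported matching determine it, since a row has at most one entry 1.
    weight-head : ∀ {k} rows cols (s s' : Code k) c c' → InjectiveFin rows → InjectiveFin cols →
      Supported Z (edges rows cols (c ∷ s)) → Supported Z (edges rows cols (c' ∷ s')) →
      weight rows cols (c ∷ s) ≐ weight rows cols (c' ∷ s') → c ≡ c'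
    weight-head rows cols s s' c c' injr injc (nz ∷ _) (nz' ∷ _) eq
      with Z (at (rows fzero) (cols c)) in z | Z (at (rows fzero) (cols c')) in z'
    ... | O | _ = contradiction refl nz
    ... | _ | O = contradiction refl nz'
    ... | I | I = injc (pos-injective (I-unique z z'))
    ... | I | V with x ← eq (rows fzero) (cols c')
      rewrite weight-otherRow (rows ∘ fsuc) (cols ∘ punchIn c) s (first≢ injr) (cols c')
            | varM-self (rows fzero) (cols c') with () ← x
    weight-head rows cols s s' c c' injr injc (nz ∷ _) (nz' ∷ _) eq | V | z₁ with x ← eq (rows fzero) (cols c)
      rewrite weight-otherRow (rows ∘ fsuc) (cols ∘ punchIn c') s' (first≢ injr) (cols c)
            | varM-self (rows fzero) (cols c)
            | +-identityʳ (entryWeight z₁ (rows fzero) (cols c') (rows fzero) (cols c))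
      = sym (injc (proj₂ (proj₂ (entryWeight-≥1 z₁ (subst (1 ≤_) x (s≤s z≤n))))))

    -- By `weight-head` a single term of the Laplace expansion contains this monomial, so up to sign
    -- its coefficient is that of the remaining factor in a smaller minor.
    coeff-weight-≢0 : ∀ {k} rows cols (s : Code k) → InjectiveFin rows → InjectiveFin cols →
      Supported Z (edges rows cols s) → ∀ {m} → m ≐ weight rows cols s → coeff (minor rows cols) m ≢ ℤ.0ℤ
    coeff-weight-≢0 rows cols [] _ _ _ {m} eq z with () ← trans (sym (coeff-yes ℤ.1ℤ [] (λ r c → sym (eq r c)))) z
    coeff-weight-≢0 {suc k} rows cols (c ∷ s) injr injc (nz ∷ sup) {m} eq z =
      coeff-weight-≢0 (rows ∘ fsuc) (cols ∘ punchIn c) s (injective-suc injr) (injective-punchIn c injc) sup (λ _ _ → refl)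
        (trans (sym (coeff-mono-* μ (minor (rows ∘ fsuc) (cols ∘ punchIn c)) eq))
        (trans (sym (cong (λ e → coeff (e *P minor (rows ∘ fsuc) (cols ∘ punchIn c)) m) (E-mono nz)))
        (coeff-signed-0⁻ (toℕ c) (laplaceTerm rows cols c) m
          (trans (sym (coeff-sumP-single term (allFin (suc k)) {m} {c} (Unique.allFin⁺ (suc k)) (∈-allFin c) others)) z))))
      where
      μ : Monomial n
      μ = entryWeight (Z (at (rows fzero) (cols c))) (rows fzero) (cols c)
      term : Fin (suc k) → Poly n
      term c = signed (toℕ c) (laplaceTerm rows cols c)
      others : ∀ c' → c' ≢ c → coeff (term c') m ≡ ℤ.0ℤ
      others c' ne with coeff (laplaceTerm rows cols c') m ℤ.≟ ℤ.0ℤ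
      ... | yes e = coeff-signed-0 (toℕ c') (laplaceTerm rows cols c') m e
      ... | no nz' with s' , sup' , eq' ← coeff-term-≢0 rows cols c' nz' =
        contradiction (weight-head rows cols s' s c' c injr injc sup' (nz ∷ sup) (λ r d → trans (eq' r d) (eq r d))) ne

    edges-at : ∀ {k} rows cols (s : Code k) {e} → e ∈ edges rows cols s → Σ (Fin n × Fin n) λ (r , c) → e ≡ at r c
    edges-at rows cols (c ∷ s) (here refl) = _ , refl
    edges-at rows cols (c ∷ s) (there x) = edges-at _ _ s x

    -- A larger monomial of the minor would come from a supported matching of the same rows and
    -- columns, and that matching would beat the one of `s`.
    leading : ∀ {k} rows cols (s : Code k) → InjectiveFin rows → InjectiveFin cols →
      Maximal Z (edges rows cols s) → IsLeadingMonomial (minor rows cols) (weight rows cols s)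
    leading rows cols s injr injc M =
      coeff-weight-≢0 rows cols s injr injc supported (λ _ _ → refl) , top
      where
      open Maximal M
      transfer : ∀ (s₁ s₂ : Code _) {r c} → weight rows cols s₁ r c ≡ weight rows cols s₂ r c →
        Z (at r c) ≡ V → at r c ∈ edges rows cols s₁ → at r c ∈ edges rows cols s₂
      transfer s₁ s₂ eq v x = proj₁ (weight-≥1⁻ rows cols s₂ (subst (1 ≤_) eq (weight-≥1 rows cols s₁ x v)))
      top : ∀ m' → coeff (minor rows cols) m' ≢ ℤ.0ℤ → ¬ weight rows cols s ≺ₘ m'
      top m' nz ((i , j) , lt , ab)
        with s' , sup' , eq' ← coeff-minor-≢0 rows cols nz
        with x , v ← weight-≥1⁻ rows cols s' (≤-trans (s≤s z≤n) (subst (weight rows cols s i j <_) (sym (eq' i j)) lt))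
        = maximal (edges rows cols s')
            (↭-reflexive (trans (rows-edges rows cols s') (sym (rows-edges rows cols s))))
            (↭-trans (cols-edges rows cols s') (↭-sym (cols-edges rows cols s)))
            sup'
            (beats (at i j) v x
              (λ y → <⇒≱ (≤-<-trans (weight-≥1 rows cols s y v) (subst (weight rows cols s i j <_) (sym (eq' i j)) lt))
                         (weight-≤1 rows cols s' injr i j))
              λ e w lt' → (λ y → f e w lt' (edges-at rows cols s' y) y) , (λ y → g e w lt' (edges-at rows cols s y) y))
        where
        order : ∀ {k l} → at i j ≺ at k l → (i , j) ≺ᵥ (k , l)
        order (inj₁ p) = inj₁ (≤-pred p)
        order (inj₂ (e , p)) = inj₂ (pos-injective e , ≤-pred p)
        f : ∀ e → Z e ≡ V → at i j ≺ e → Σ (Fin n × Fin n) (λ (r , c) → e ≡ at r c) →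
          e ∈ edges rows cols s' → e ∈ edges rows cols s
        f _ w lt' ((k , l) , refl) y = transfer s' s (trans (eq' k l) (sym (ab k l (order lt')))) w y
        g : ∀ e → Z e ≡ V → at i j ≺ e → Σ (Fin n × Fin n) (λ (r , c) → e ≡ at r c) →
          e ∈ edges rows cols s → e ∈ edges rows cols s'
        g _ w lt' ((k , l) , refl) y = transfer s s' (trans (ab k l (order lt')) (sym (eq' k l))) w y

-- Increasing enumerations

enumerate : ∀ n ys → AllPairs.AllPairs _<_ ys → All (λ y → 1 ≤ y × y ≤ n) ys →
  Σ (Fin (length ys) → Fin n) λ f → StrictlyIncreasing f × tabulate (pos ∘ f) ≡ ys
enumerate n [] _ _ = (λ ()) , (λ ()) , refl
enumerate n (suc y ∷ ys) (y< ∷ inc) ((_ , y<n) ∷ b) with f , f-inc , eq ← enumerate n ys inc b =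
  g , g-inc , cong₂ _∷_ (cong suc (toℕ-fromℕ< y<n)) eq
  where
  g : Fin (suc (length ys)) → Fin n
  g fzero = fromℕ< y<n
  g (fsuc a) = f a
  g-inc : StrictlyIncreasing g
  g-inc fzero (fsuc b) _ = ≤-pred (subst (_< pos (f b)) (cong suc (sym (toℕ-fromℕ< y<n)))
    (All.lookup y< (subst (pos (f b) ∈_) eq (∈-tabulate⁺ {f = pos ∘ f} b))))
  g-inc (fsuc a) (fsuc b) lt = f-inc a b (≤-pred lt)
enumerate n (zero ∷ _) _ ((() , _) ∷ _)

sortedEnumeration : ∀ n k xs → length xs ≡ k → Unique xs → All (λ y → 1 ≤ y × y ≤ n) xs →
  Σ (Fin k → Fin n) λ f → StrictlyIncreasing f × tabulate (pos ∘ f) ↭ xs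
sortedEnumeration n _ xs refl u b
  rewrite sym (↭-length (sort-↭ xs))
  with f , inc , eq ← enumerate n (sort xs)
         (AllPairs.zipWith (λ (a , b) → ≤∧≢⇒< a b)
           (Linked⇒AllPairs ≤-trans (sort-↗ xs) , Unique-resp-↭ (↭-sym (sort-↭ xs)) u))
         (All-resp-↭ (↭-sym (sort-↭ xs)) b)
  = f , inc , ↭-trans (↭-reflexive eq) (sort-↭ xs)

increasing⇒injective : ∀ {k n} {f : Fin k → Fin n} → StrictlyIncreasing f → InjectiveFin f
increasing⇒injective {f = f} inc {a} {b} eq with <-cmp (toℕ a) (toℕ b)
... | tri< lt _ _ = contradiction (inc a b lt) (<-irrefl (cong toℕ eq))
... | tri≈ _ e _ = toℕ-injective e
... | tri> _ _ gt = contradiction (inc b a gt) (<-irrefl (cong toℕ (sym eq)))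

open Perm

-- Violations of the rank conditions propagate to the essential set

-- An injective `u` takes the value `suc i` at most once.
R-row-≤-suc : ∀ {u} → Injective u → ∀ i j → R u (suc i) j ≤ suc (R u i j)
R-row-≤-suc inj i zero = z≤n
R-row-≤-suc {u} inj i (suc j) with <-cmp (u (suc j)) (suc i)
... | tri< lt _ _ rewrite R-yes u (suc i) j (<⇒≤ lt) | R-yes u i j (≤-pred lt) = s≤s (R-row-≤-suc inj i j)
... | tri≈ _ eq _ rewrite R-yes u (suc i) j (≤-reflexive eq) = s≤s (≤-trans
      (cnt-mono {λ m → u m ≤ᵇ suc i} {λ m → u m ≤ᵇ i} j λ m _ m≤j t → ≤⇒true (≤-pred (≤∧≢⇒< (true⇒≤ t) λ e →
        <⇒≢ (s≤s m≤j) (inj (trans e (sym eq))))))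
      (R-mono-suc u i j))
... | tri> _ _ gt rewrite R-no u (suc i) j (<⇒≱ gt) | R-no u i j (<⇒≱ (<-trans ≤-refl gt)) = R-row-≤-suc inj i j

R-row-mono : ∀ u i j → R u i j ≤ R u (suc i) j
R-row-mono u i j = cnt-mono {λ m → u m ≤ᵇ i} {λ m → u m ≤ᵇ suc i} j λ m _ _ t → ≤⇒true (m≤n⇒m≤1+n (true⇒≤ {u m} {i} t))

R-row-zero : ∀ {u} → Injective u → u 0 ≡ 0 → ∀ j → R u 0 j ≡ 0
R-row-zero inj u0 zero = refl
R-row-zero {u} inj u0 (suc j) with u (suc j) in eq
... | zero with () ← inj (trans eq (sym u0))
... | suc _ = trans (+-identityʳ _) (R-row-zero inj u0 j)

module _ {n : ℕ} (x : Perm n) (u : ℕ → ℕ) (u-injective : Injective u) (u-zero : u 0 ≡ 0) where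

  Violated : ℕ → ℕ → Set
  Violated i j = R (to x) i j < R u i j

  record ViolatedBox (i j : ℕ) : Set where
    constructor violatedBox
    field
      1≤i : 1 ≤ i
      1≤j : 1 ≤ j
      i≤n : i ≤ n
      j≤n : j ≤ n
      inBox : box x i j ≡ true
      violated : Violated i j

  -- If `to x j ≤ i`, leaving out column `j` lowers `R (to x)` by exactly one and `R u` by at most
  -- one, so the strict inequality survives. Row `i` is left out in the same way if its 1 lies in
  -- the first `j` columns. If neither applies, `(i , j)` is a box. The bound `s` on `i + j` serves
  -- termination.
  violation⇒box : ∀ s i j → i + j ≤ s → i ≤ n → j ≤ n → Violated i j → Σ (ℕ × ℕ) λ (i , j) → ViolatedBox i j
  violation⇒box s i zero _ _ _ ()
  violation⇒box s zero (suc j) _ _ _ viol =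
    contradiction (subst (R (to x) 0 (suc j) <_) (R-row-zero u-injective u-zero (suc j)) viol) λ ()
  violation⇒box (suc s) i@(suc i₀) j@(suc j₀) le i≤n j≤n viol with to x j ≤? i
  ... | yes p = violation⇒box s i j₀ (≤-pred (subst (_≤ suc s) (+-suc i j₀) le)) i≤n (<⇒≤ j≤n)
                  (≤-pred (≤-trans (subst (_< R u i j) (R-yes (to x) i j₀ p) viol) (R-≤-suc u i j₀)))
  ... | no p with from x i ≤? j
  ...   | no q = (i , j) , violatedBox (s≤s z≤n) (s≤s z≤n) i≤n j≤n (box⁺ x (≰⇒> p) (≰⇒> q)) viol
  ...   | yes q = violation⇒box s i₀ j (≤-pred le) (<⇒≤ i≤n) j≤n
                    (≤-pred (≤-trans (s≤s R<) (≤-trans viol (R-row-≤-suc u-injective i₀ j))))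
    where
    R< : R (to x) i₀ j < R (to x) i j
    R< = cnt-mono-< {λ m → to x m ≤ᵇ i₀} {λ m → to x m ≤ᵇ i} j
           (λ m _ _ t → ≤⇒true (m≤n⇒m≤1+n (true⇒≤ {to x m} {i₀} t)))
           (from x i) (from-≥1 x (s≤s z≤n)) q
           (λ t → <⇒≱ ≤-refl (subst (_≤ i₀) (to-from x i) (true⇒≤ t)))
           (≤⇒true (≤-reflexive (to-from x i)))

  record ViolatedEssential : Set where
    constructor violatedEssential
    field
      {i j} : ℕ
      isBox : ViolatedBox i j
      over : box x (suc i) j ≢ true
      beside : box x i (suc j) ≢ true

  -- From a box to a box directly above it or to its right, `R (to x)` does not grow and `R u` does
  -- not decrease. Boxes stay inside the grid, so `s` bounds the number of moves left.
  box⇒essential : ∀ s i j → n + n ≤ s + (i + j) → ViolatedBox i j → ViolatedEssential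
  box⇒essential s i j le vb@(violatedBox 1≤i 1≤j i≤n j≤n b viol) = go s le
    (box x (suc i) j) refl (box x i (suc j)) refl
    where
    i<to = proj₁ (box⁻ x b)
    j<from = proj₂ (box⁻ x b)
    i<n = <-≤-trans i<to (to-≤ x j≤n)
    j<n = <-≤-trans j<from (from-≤ x i≤n)
    up : box x (suc i) j ≡ true → ViolatedBox (suc i) j
    up b' = violatedBox (s≤s z≤n) 1≤j i<n j≤n b' (≤-<-trans same (<-≤-trans viol (R-row-mono u i j)))
      where
      same : R (to x) (suc i) j ≤ R (to x) i j
      same = cnt-mono {λ m → to x m ≤ᵇ suc i} {λ m → to x m ≤ᵇ i} j λ m _ m≤j t →
        ≤⇒true (≤-pred (≤∧≢⇒< (true⇒≤ t) λ e →
          <⇒≱ (proj₂ (box⁻ x b')) (subst (_≤ j) (trans (sym (from-to x m)) (cong (from x) e)) m≤j)))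
    along : box x i (suc j) ≡ true → ViolatedBox i (suc j)
    along b' = violatedBox 1≤i (s≤s z≤n) i≤n j<n b'
      (subst (_< R u i (suc j)) (sym (R-no (to x) i j (<⇒≱ (proj₁ (box⁻ x b'))))) (<-≤-trans viol (R-mono-suc u i j)))
    go : ∀ s → n + n ≤ s + (i + j) → ∀ a → box x (suc i) j ≡ a → ∀ r → box x i (suc j) ≡ r → ViolatedEssential
    go s le false ea false er = violatedEssential vb (λ t → true≢false t ea) (λ t → true≢false t er)
    go zero le _ _ _ _ = contradiction le (<⇒≱ (+-mono-<-≤ i<n (<⇒≤ j<n)))
    go (suc s) le true ea _ _ = box⇒essential s (suc i) j (subst (n + n ≤_) (sym (+-suc s (i + j))) le) (up ea)
    go (suc s) le false _ true er = box⇒essential s i (suc j)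
      (subst (n + n ≤_) (trans (sym (+-suc s (i + j))) (cong (s +_) (sym (+-suc i j)))) le) (along er)

-- From S_n to permutations of ℕ

ext : ∀ {n} → (Fin n → Fin n) → ℕ → ℕ
ext f zero = zero
ext {n} f (suc t) with t <? n
... | yes t<n = pos (f (fromℕ< t<n))
... | no _ = suc t

ext-pos : ∀ {n} (f : Fin n → Fin n) c → ext f (pos c) ≡ pos (f c)
ext-pos {n} f c with toℕ c <? n
... | yes lt = cong (pos ∘ f) (fromℕ<-toℕ c lt)
... | no ge = contradiction (toℕ<n c) ge

ext-big : ∀ {n} (f : Fin n → Fin n) x → n < x → ext f x ≡ x
ext-big {n} f (suc t) n<x with t <? n
... | yes lt = contradiction n<x (≤⇒≯ lt)
... | no _ = refl

ext-inverse : ∀ {n} (f g : Fin n → Fin n) → (∀ c → g (f c) ≡ c) → ∀ x → ext g (ext f x) ≡ x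
ext-inverse f g inv zero = refl
ext-inverse {n} f g inv (suc t) with t <? n
... | yes lt = trans (ext-pos g _) (trans (cong pos (inv _)) (cong suc (toℕ-fromℕ< lt)))
... | no ge = ext-big g (suc t) (s≤s (≮⇒≥ ge))

w₀· : ∀ {n} → Permutation′ n → Perm n
w₀· v = record
  { to = ext f
  ; from = ext g
  ; from-to = ext-inverse f g λ c → trans (cong (v ⟨$⟩ˡ_) (opposite-involutive _)) (inverseˡ v)
  ; to-from = ext-inverse g f λ r → trans (cong opposite (inverseʳ v)) (opposite-involutive r)
  ; to-zero = refl
  ; to-big = ext-big f
  }
  where
  f = opposite ∘ (v ⟨$⟩ʳ_)
  g = (v ⟨$⟩ˡ_) ∘ opposite

to-w₀· : ∀ {n} (v : Permutation′ n) c → to (w₀· v) (pos c) ≡ n + 1 ∸ val v c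
to-w₀· {n} v c = begin
  to (w₀· v) (pos c)         ≡⟨ ext-pos _ c ⟩
  pos (opposite (v ⟨$⟩ʳ c))  ≡⟨ cong suc (opposite-prop (v ⟨$⟩ʳ c)) ⟩
  suc (n ∸ val v c)          ≡⟨ +-∸-assoc 1 (toℕ<n (v ⟨$⟩ʳ c)) ⟨
  1 + n ∸ val v c            ≡⟨ cong (_∸ val v c) (+-comm 1 n) ⟩
  n + 1 ∸ val v c            ∎
  where open ≡-Reasoning

from-w₀· : ∀ {n} (v : Permutation′ n) r → from (w₀· v) (pos r) ≡ inv v (opposite r)
from-w₀· v r = ext-pos _ r

-- Reconciles the order of tests in `Zentry` with that in `matrix`; `f` stands for the polynomial
-- assigned to each kind of entry.
matrix-cases : ∀ {n} (ρ : Perm n) i j {A : Set} (f : Entry → A) →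
  (if i ≡ᵇ to ρ j then f I else if from ρ i <ᵇ j then f O else if to ρ j <ᵇ i then f O else f V) ≡ f (matrix ρ (i , j))
matrix-cases ρ i j f with <-cmp i (to ρ j) | <-cmp (from ρ i) j
... | tri≈ _ eq _ | _ rewrite ≡⇒true eq = refl
... | tri< _ ne _ | tri< lt _ gt rewrite ≢⇒false ne | <⇒true lt | ≮⇒false gt | ∧-zeroʳ (i <ᵇ to ρ j) = refl
... | tri< lt ne gt | tri> ge _ lt' rewrite ≢⇒false ne | ≮⇒false ge | <⇒true lt' | <⇒true lt | ≮⇒false gt = refl
... | tri< _ ne _ | tri≈ _ eq _ = contradiction (trans (sym (to-from ρ i)) (cong (to ρ) eq)) ne
... | tri> ge ne gt | _ rewrite ≢⇒false ne | ≮⇒false ge | <⇒true gt with from ρ i <ᵇ j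
...   | true = refl
...   | false = refl

module _ {n : ℕ} (v : Permutation′ n) where

  inD≡box : ∀ r c → inD v r c ≡ box (w₀· v) (pos r) (pos c)
  inD≡box r c = cong₂ (λ t f → (pos r <ᵇ t) ∧ (pos c <ᵇ f)) (sym (to-w₀· v c)) (sym (from-w₀· v r))

  cnt-restrict : ∀ g {j} m → j ≤ m → cnt (λ k → (k ≤ᵇ j) ∧ g k) m ≡ cnt g j
  cnt-restrict g {j} m j≤m with j ≟ m
  cnt-restrict g m j≤m | yes refl = cnt-cong m λ k _ k≤m → cong (_∧ g k) (≤⇒true k≤m)
  cnt-restrict g zero z≤n | no ne = contradiction refl ne
  cnt-restrict g {j} (suc m) j≤m | no ne =
    trans (cong₂ _+_ (cnt-restrict g m (≤-pred (≤∧≢⇒< j≤m ne)))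
                     (cong (λ b → indicator (b ∧ g (suc m))) (≰⇒false (ne ∘ ≤-antisym j≤m))))
          (+-identityʳ _)

  -- `n + 1 - i ≤ v k` and `n + 1 - v k ≤ i` are the same condition, the latter being a bound on the
  -- value of `w₀v` at `k`.
  rank≡R : ∀ r c → rank v r c ≡ R (to (w₀· v)) (pos r) (pos c)
  rank≡R r c = trans
    (count≡cnt {n} _ (λ k → (k ≤ᵇ pos c) ∧ (to (w₀· v) k ≤ᵇ pos r)) λ k → cong ((pos k ≤ᵇ pos c) ∧_)
      (Bool-ext (λ t → ≤⇒true (subst (_≤ pos r) (sym (to-w₀· v k)) (flip (pos r) (val v k) (true⇒≤ t))))
                (λ t → ≤⇒true (flip (val v k) (pos r) (subst (_≤ pos r) (to-w₀· v k) (true⇒≤ t))))))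
    (cnt-restrict (λ k → to (w₀· v) k ≤ᵇ pos r) n (toℕ<n c))
    where
    flip : ∀ a b → n + 1 ∸ a ≤ b → n + 1 ∸ b ≤ a
    flip a b le = m≤n+o⇒m∸n≤o (n + 1) b (≤-trans (m≤n+m∸n (n + 1) a) (≤-trans (+-monoʳ-≤ a le) (≤-reflexive (+-comm a b))))

  label≡ : ∀ r c → label v r c ≡ pos r + cnt (box (w₀· v) (pos r)) (toℕ c)
  label≡ r c = cong (pos r +_) (trans
    (count≡cnt {n} _ (λ k → (k ≤ᵇ toℕ c) ∧ box (w₀· v) (pos r) k) λ k → cong ((toℕ k <ᵇ toℕ c) ∧_) (inD≡box r k))
    (cnt-restrict (box (w₀· v) (pos r)) n (<⇒≤ (toℕ<n c))))

  open Minors {n} (matrix (w₀· v)) (Zentry v) using (entryPoly)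

  Zentry≡ : ∀ r c → Zentry v r c ≡ entryPoly (matrix (w₀· v) (pos r , pos c)) r c
  Zentry≡ r c = trans
    (cong₂ (λ t f → if pos r ≡ᵇ t then 1P else if f <ᵇ pos c then 0P else if t <ᵇ pos r then 0P else varP r c)
      (sym (to-w₀· v c)) (sym (from-w₀· v r)))
    (matrix-cases (w₀· v) (pos r) (pos c) λ z → entryPoly z r c)

-- Reading words

catTo : (ℕ → List ℕ) → ℕ → List ℕ
catTo h zero = []
catTo h (suc m) = catTo h m ++ h (suc m)

catTo-head : ∀ h m → catTo h (suc m) ≡ h 1 ++ catTo (h ∘ suc) m
catTo-head h zero = sym (++-identityʳ (h 1))
catTo-head h (suc m) = trans (cong (_++ h (suc (suc m))) (catTo-head h m)) (++-assoc (h 1) _ _)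

concat-tabulate : ∀ {n} (f : Fin n → List ℕ) h → (∀ c → f c ≡ h (pos c)) → concat (tabulate f) ≡ catTo h n
concat-tabulate {zero} f h eq = refl
concat-tabulate {suc n} f h eq =
  trans (cong₂ _++_ (eq fzero) (concat-tabulate (f ∘ fsuc) (h ∘ suc) (eq ∘ fsuc))) (sym (catTo-head h n))

extSubset : ∀ {n} → Subset² n → Edge → Bool
extSubset {n} S (suc a , suc b) with a <? n | b <? n
... | yes p | yes q = S (fromℕ< p) (fromℕ< q)
... | _ | _ = false
extSubset S _ = false

extSubset-pos : ∀ {n} (S : Subset² n) r c → extSubset S (pos r , pos c) ≡ S r c
extSubset-pos {n} S r c with toℕ r <? n | toℕ c <? n
... | yes p | yes q = cong₂ S (fromℕ<-toℕ r p) (fromℕ<-toℕ c q)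
... | no p | _ = contradiction (toℕ<n r) p
... | yes _ | no q = contradiction (toℕ<n c) q

module _ {n : ℕ} (v : Permutation′ n) where

  allPositions : List (Fin n × Fin n)
  allPositions = cartesianProduct (reverse (allFin n)) (allFin n)

  positionLabel : Fin n × Fin n → ℕ
  positionLabel (r , c) = label v r c

  -- The form that `subword` works with: a list of distinct positions, to which the labels are
  -- applied only at the end.
  readingWord≡map : ∀ P → readingWord v P ≡ map positionLabel (filterᵇ (λ (r , c) → P r c) allPositions)
  readingWord≡map P = go (reverse (allFin n))
    where
    row : ∀ r cs → map (label v r) (filterᵇ (P r) cs) ≡
      map positionLabel (filterᵇ (λ (r , c) → P r c) (map (r ,_) cs))
    row r [] = refl
    row r (c ∷ cs) with P r c
    ... | true = cong (label v r c ∷_) (row r cs)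
    ... | false = row r cs
    go : ∀ rs → concatMap (λ r → map (label v r) (filterᵇ (P r) (allFin n))) rs ≡
      map positionLabel (filterᵇ (λ (r , c) → P r c) (cartesianProduct rs (allFin n)))
    go [] = refl
    go (r ∷ rs) = begin
      map (label v r) (filterᵇ (P r) (allFin n)) ++ _
        ≡⟨ cong₂ _++_ (row r (allFin n)) (go rs) ⟩
      map positionLabel (filterᵇ P′ (map (r ,_) (allFin n))) ++ map positionLabel (filterᵇ P′ (cartesianProduct rs (allFin n)))
        ≡⟨ map-++ positionLabel (filterᵇ P′ (map (r ,_) (allFin n))) _ ⟨
      map positionLabel (filterᵇ P′ (map (r ,_) (allFin n)) ++ filterᵇ P′ (cartesianProduct rs (allFin n)))
        ≡⟨ cong (map positionLabel) (filter-++ (T? ∘ P′) (map (r ,_) (allFin n)) _) ⟨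
      map positionLabel (filterᵇ P′ (cartesianProduct (r ∷ rs) (allFin n))) ∎
      where
      open ≡-Reasoning
      P′ : Fin n × Fin n → Bool
      P′ (r , c) = P r c

  complement : Subset² n → Subset² n
  complement S r c = inD v r c ∧ not (S r c)

  map-filterᵇ : ∀ {A B : Set} (f : A → B) p xs →
    map f (filterᵇ p xs) ≡ concat (map (λ x → if p x then f x ∷ [] else []) xs)
  map-filterᵇ f p [] = refl
  map-filterᵇ f p (x ∷ xs) with p x
  ... | true = cong (f x ∷_) (map-filterᵇ f p xs)
  ... | false = map-filterᵇ f p xs

  module _ (S : Subset² n) where

    ρ : Perm n
    ρ = w₀· v

    rowLetters : ℕ → ℕ → List ℕ
    rowLetters r c = letterIf (box ρ r c) (extSubset S (r , c)) (r + cnt (box ρ r) (c ∸ 1))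

    rowWord≡catTo : ∀ r m → rowWord ρ (extSubset S) r m ≡ catTo (rowLetters r) m
    rowWord≡catTo r zero = refl
    rowWord≡catTo r (suc m) = cong (_++ rowLetters r (suc m)) (rowWord≡catTo r m)

    readingRow : ∀ r → map (label v r) (filterᵇ (complement S r) (allFin n)) ≡ rowWord ρ (extSubset S) (pos r) n
    readingRow r = begin
      map (label v r) (filterᵇ (complement S r) (allFin n))  ≡⟨ map-filterᵇ (label v r) (complement S r) (allFin n) ⟩
      concat (map letters (allFin n))                        ≡⟨ cong concat (map-tabulate id letters) ⟩
      concat (tabulate letters)                              ≡⟨ concat-tabulate letters (rowLetters (pos r)) same ⟩
      catTo (rowLetters (pos r)) n                           ≡⟨ rowWord≡catTo (pos r) n ⟨
      rowWord ρ (extSubset S) (pos r) n                      ∎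
      where
      open ≡-Reasoning
      letters : Fin n → List ℕ
      letters c = if complement S r c then label v r c ∷ [] else []
      same : ∀ c → letters c ≡ rowLetters (pos r) (pos c)
      same c = letterIf-cong (inD≡box v r c) (sym (extSubset-pos S r c)) (label≡ v r c)

    rowsWord≡concat : ∀ {t} p (f : Fin t → List ℕ) → (∀ r → f r ≡ rowWord ρ (extSubset S) (p + toℕ r) n) →
      concat (reverse (tabulate f)) ≡ rowsWord ρ (extSubset S) t p
    rowsWord≡concat {zero} p f eq = refl
    rowsWord≡concat {suc t} p f eq = begin
      concat (reverse (tabulate f))
        ≡⟨ cong concat (unfold-reverse (f fzero) (tabulate (f ∘ fsuc))) ⟩
      concat (reverse (tabulate (f ∘ fsuc)) ++ f fzero ∷ [])
        ≡⟨ concat-++ (reverse (tabulate (f ∘ fsuc))) (f fzero ∷ []) ⟨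
      concat (reverse (tabulate (f ∘ fsuc))) ++ f fzero ++ []
        ≡⟨ cong₂ _++_
             (rowsWord≡concat (suc p) (f ∘ fsuc) λ r →
               trans (eq (fsuc r)) (cong (λ i → rowWord ρ (extSubset S) i n) (+-suc p (toℕ r))))
             (trans (++-identityʳ _) (trans (eq fzero) (cong (λ i → rowWord ρ (extSubset S) i n) (+-identityʳ p)))) ⟩
      rowsWord ρ (extSubset S) (suc t) p ∎
      where open ≡-Reasoning

    readingWord-complement : readingWord v (complement S) ≡ rowsWord ρ (extSubset S) n 1
    readingWord-complement = begin
      concat (map f (reverse (allFin n)))  ≡⟨ cong concat (reverse-map f (allFin n)) ⟩
      concat (reverse (map f (allFin n)))  ≡⟨ cong (concat ∘ reverse) (map-tabulate id f) ⟩
      concat (reverse (tabulate f))        ≡⟨ rowsWord≡concat 1 f readingRow ⟩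
      rowsWord ρ (extSubset S) n 1         ∎
      where
      open ≡-Reasoning
      f : Fin n → List ℕ
      f r = map (label v r) (filterᵇ (complement S r) (allFin n))

    claim-complement : Claim {n} (matrix ρ) (extSubset S) (readingWord v (complement S))
    claim-complement = subst (Claim (matrix ρ) (extSubset S)) (sym readingWord-complement)
      (claim n 1 (from ρ 1 ∸ 1) ρ (extSubset S) refl ≤-refl (λ { zero _ → refl ; (suc _) (s≤s ()) })
        (sym (m+[n∸m]≡n (from-≥1 ρ ≤-refl))))

-- From nonfaces to essential minors.

demazure-zero : ∀ n W → All (1 ≤_) W → demazure n W 0 ≡ 0
demazure-zero n W = go (reverseView W)
  where
  go : ∀ {W} → Reverse W → All (1 ≤_) W → demazure n W 0 ≡ 0
  go []ʳ _ = refl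
  go (W ∶ r ∶ʳ a) ge with geW , 1≤a ∷ [] ← All.++⁻ W ge =
    demazure-preserves (λ δ → δ 0 ≡ 0) n W a (go r geW)
      (trans (cong (demazure n W) (sℕ-other (<⇒≢ 1≤a) (λ ()))) (go r geW))

filterᵇ-∧ : ∀ {A : Set} (p q : A → Bool) xs → filterᵇ (λ x → p x ∧ q x) xs ≡ filterᵇ q (filterᵇ p xs)
filterᵇ-∧ p q [] = refl
filterᵇ-∧ p q (x ∷ xs) with p x
... | false = filterᵇ-∧ p q xs
... | true with q x
...   | true = cong (x ∷_) (filterᵇ-∧ p q xs)
...   | false = filterᵇ-∧ p q xs

module _ {n : ℕ} (v w : Permutation′ n) (S : Subset² n) where

  private
    x : Perm n
    x = w₀· w
    W : List ℕ
    W = readingWord v (complement v S)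
    u : ℕ → ℕ
    u = demazure n W

  dominated⇒face : S ⊆D v → (∀ i j → i ≤ n → j ≤ n → R u i j ≤ R (to x) i j) → IsFace v w S
  dominated⇒face S⊆D dom = S⊆D , P , P⊆ , isPipeDream
    where
    P₀ : Fin n × Fin n → Bool
    P₀ (r , c) = complement v S r c
    L : List (Fin n × Fin n)
    L = filterᵇ P₀ (allPositions v)
    W≡ : W ≡ map (positionLabel v) L
    W≡ = readingWord≡map v (complement v S)
    open Subword (Product.≡-dec Data.Fin._≟_ Data.Fin._≟_) (positionLabel v) n using (subword)
    L-unique : Unique L
    L-unique = Unique.filter⁺ (T? ∘ P₀) (Unique.cartesianProduct⁺
      (Unique-resp-↭ (↭-sym (↭-reverse (allFin n))) (Unique.allFin⁺ n)) (Unique.allFin⁺ n))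
    sub = subword L L-unique
      (All.map⁻ (subst (All ValidLetter) W≡ (Claim.valid (claim-complement v S))))
      (to x) (to-injective x) (to-zero x)
      λ i j i≤n j≤n → subst (λ W → R (demazure n W) i j ≤ R (to x) i j) W≡ (dom i j i≤n j≤n)
    -- The choice returned by `subword` is unrestricted outside `L`, so it is cut down to the
    -- complement of `S` in the diagram.
    P : Subset² n
    P r c = complement v S r c ∧ proj₁ sub (r , c)
    P⊆ : ∀ r c → P r c ≡ true → InD v r c × S r c ≡ false
    P⊆ r c t with inD v r c | S r c
    ... | true | false = refl , refl
    isPipeDream : IsPipeDreamFor-w₀w v w P
    isPipeDream k = begin
      demazure n (readingWord v P) (pos k)
        ≡⟨ cong (λ W → demazure n W (pos k)) (trans (readingWord≡map v P)
             (cong (map (positionLabel v)) (filterᵇ-∧ P₀ (proj₁ sub) (allPositions v)))) ⟩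
      demazure n (map (positionLabel v) (filterᵇ (proj₁ sub) L)) (pos k)
        ≡⟨ proj₂ sub (pos k) (toℕ<n k) ⟩
      to x (pos k)
        ≡⟨ to-w₀· w k ⟩
      n + 1 ∸ val w k ∎
      where open ≡-Reasoning

  essential⇒minor : ∀ r c → Essential w r c → rank w r c < R u (pos r) (pos c) →
    Σ (EssentialMinor v w) λ M → Σ (Monomial n) λ m → IsLeadingMonomial (minorPoly M) m × (m ∣ₘ monoOf S)
  essential⇒minor r c ess lt
    -- `lt` is by definition `suc (rank w r c) ≤ R u (pos r) (pos c)`, the hypothesis of `found` for
    -- the size of an essential minor.
    with σ , G ← Claim.found (claim-complement v S) (pos r) (pos c) (suc (rank w r c)) lt
    with rows , rows-inc , rows↭ ← sortedEnumeration n (suc (rank w r c)) (rowsOf σ)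
           (trans (length-map proj₁ σ) (Good.size G)) (Good.unique-rows G)
           (All.map⁺ (All.map (λ b → row≥1 b , ≤-trans (row≤ b) (toℕ<n r)) (Good.within G)))
    with cols , cols-inc , cols↭ ← sortedEnumeration n (suc (rank w r c)) (colsOf σ)
           (trans (length-map proj₂ σ) (Good.size G)) (Good.unique-cols G)
           (All.map⁺ (All.map (λ b → col≥1 b , ≤-trans (col≤ b) (toℕ<n c)) (Good.within G)))
    with s , σ↭ ← Minors.encode (matrix (w₀· v)) (Zentry v) rows cols σ (↭-sym rows↭) (↭-sym cols↭)
    = M , weight rows cols s ,
      leading (Zentry≡ v) (λ {i} → I-unique {i}) rows cols s (increasing⇒injective rows-inc) (increasing⇒injective cols-inc)
        (Maximal-resp-↭ σ↭ (Good.isMaximal G)) ,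
      divides
    where
    open Minors (matrix (w₀· v)) (Zentry v) hiding (encode)
    I-unique : ∀ {i j j'} → matrix (w₀· v) (i , j) ≡ I → matrix (w₀· v) (i , j') ≡ I → j ≡ j'
    I-unique {i} p q =
      to-injective (w₀· v) (trans (sym (matrix-I⁻ (w₀· v) {i} p)) (matrix-I⁻ (w₀· v) {i} q))
    M : EssentialMinor v w
    M = record
      { r = r ; c = c ; ess = ess ; rows = rows ; cols = cols
      ; rows-inc = rows-inc ; cols-inc = cols-inc
      ; rows-bot = λ a → All.lookup (All.map⁺ {f = proj₁} (All.map row≤ (Good.within G)))
                           (∈-resp-↭ rows↭ (∈-tabulate⁺ {f = pos ∘ rows} a))
      ; cols-lft = λ a → All.lookup (All.map⁺ {f = proj₂} (All.map col≤ (Good.within G)))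
                           (∈-resp-↭ cols↭ (∈-tabulate⁺ {f = pos ∘ cols} a))
      }
    -- A positive exponent comes from a variable edge of the matching, which lies in `S` by
    -- `chosen`; squarefreeness bounds it by the exponent 1 in `monoOf S`.
    divides : weight rows cols s ∣ₘ monoOf S
    divides r c with weight rows cols s r c in eq
    ... | zero = z≤n
    ... | suc _ with x , y ← weight-≥1⁻ rows cols s {r} {c} (subst (1 ≤_) (sym eq) (s≤s z≤n))
      rewrite trans (sym (extSubset-pos S r c)) (All.lookup (Good.chosen G) (∈-resp-↭ (↭-sym σ↭) x) y) =
      subst (_≤ 1) eq (weight-≤1 rows cols s (increasing⇒injective rows-inc) r c)

  violation⇒minor : ∀ i j → i ≤ n → j ≤ n → R (to x) i j < R u i j →
    Σ (EssentialMinor v w) λ M → Σ (Monomial n) λ m → IsLeadingMonomial (minorPoly M) m × (m ∣ₘ monoOf S)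
  violation⇒minor i j i≤n j≤n viol
    with (i' , j') , vb ← violation⇒box x u (demazure-injective n W)
           (demazure-zero n W (All.map proj₁ (Claim.valid (claim-complement v S)))) (i + j) i j ≤-refl i≤n j≤n viol
    with violatedEssential {suc i″} {suc j″} (violatedBox _ _ i<n j<n b viol') over beside
           ← box⇒essential x u (demazure-injective n W)
               (demazure-zero n W (All.map proj₁ (Claim.valid (claim-complement v S)))) (n + n) i' j' (m≤m+n _ _) vb
    = essential⇒minor r c ess (subst₂ _<_ (trans (cong₂ (R (to x)) (sym pos-r) (sym pos-c)) (sym (rank≡R w r c)))
                                          (cong₂ (R u) (sym pos-r) (sym pos-c)) viol')
    where
    r = fromℕ< i<n
    c = fromℕ< j<n
    pos-r : pos r ≡ suc i″
    pos-r = cong suc (toℕ-fromℕ< i<n)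
    pos-c : pos c ≡ suc j″
    pos-c = cong suc (toℕ-fromℕ< j<n)
    ess : Essential w r c
    ess = trans (inD≡box w r c) (trans (cong₂ (box x) pos-r pos-c) b)
        , (λ r' e t → over (trans (cong₂ (box x) (sym (trans e (cong suc pos-r))) (sym pos-c))
                                   (trans (sym (inD≡box w r' c)) t)))
        , (λ c' e t → beside (trans (cong₂ (box x) (sym pos-r) (sym (trans e (cong suc pos-c))))
                                   (trans (sym (inD≡box w r c')) t)))

theorem6p1 : (n : ℕ) (v w : Permutation′ n) (S : Subset² n) →
    S ⊆D v → ¬ IsFace v w S →
    Σ (EssentialMinor v w) λ M → Σ (Monomial n) λ m →
    IsLeadingMonomial (minorPoly M) m × (m ∣ₘ monoOf S)
theorem6p1 n v w S S⊆D nonface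
  -- The exclusive bound `suc n` lets both indices run from 0 to `n`, so a failed search is
  -- domination in the full range required by `dominated⇒face`.
  with anyUpTo? (λ i → anyUpTo? (λ j → R (to (w₀· w)) i j <? R (demazure n (readingWord v (complement v S))) i j) (suc n)) (suc n)
... | yes (i , i<1+n , j , j<1+n , viol) = violation⇒minor v w S i j (≤-pred i<1+n) (≤-pred j<1+n) viol
... | no none = contradiction
  (dominated⇒face v w S S⊆D λ i j i≤n j≤n → ≮⇒≥ λ viol → none (i , s≤s i≤n , j , s≤s j≤n , viol)) nonface
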